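{- Let $G$ be a finite simple undirected graph that is $\{P_5, \mathrm{Flag}^C\}$-free, i.e. $G$ contains no induced subgraph isomorphic to $P_5$ and no induced subgraph isomorphic to $\mathrm{Flag}^C$. Then $$\chi(G) \leq \left\lceil \frac{\Delta(G) + \omega(G) + 1}{2} \right\rceil .$$
   Context: All graphs are finite, simple and undirected. For a graph $G$, $\chi(G)$ denotes its chromatic number, $\omega(G)$ the size of a maximum clique, and $\Delta(G)$ the maximum degree. For a family $\mathcal{F}$ of graphs, $G$ is $\mathcal{F}$-free if no induced subgraph of $G$ is isomorphic to a member of $\mathcal{F}$. $P_5$ is the path on 5 vertices. $\mathrm{Flag}^C$ (the complement of the graph called Flag) is the graph on 5 vertices $a,b,c,d,e$ with edge set exactly $\{ab, bc, cd, da, ae\}$, i.e. a chordless 4-cycle together with one pendant vertex attached to one vertex of the cycle. (Equivalently, Flag is a triangle with a path of length 2 attached at one of its vertices.) -}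

module Defs where

open import Data.Empty using (⊥-elim)
open import Data.Fin.Base using (Fin; finToFun; funToFin)
open import Data.Fin.Patterns using (0F; 1F; 2F; 3F; 4F)
open import Data.Fin.Properties using (_≟_; all?; any?; finToFun-funToFin)
open import Data.Fin.Subset as Subset using (Subset; ∣_∣)
open import Data.Fin.Subset.Properties using (_∈?_; anySubset?; ∣p∣≤n; ∣⊥∣≡0; ∉⊥)
open import Data.List.Base using (List; []; _∷_; map; allFin)
open import Data.List.Extrema.Nat using (max)
open import Data.List.Membership.Propositional using (_∈_)
import Data.List.Membership.DecPropositional as DecMembership
open import Data.List.Relation.Unary.All as All using (All)
open import Data.Nat.Base using (ℕ; zero; suc; _≤_; z≤n; s≤s)
import Data.Nat.Properties as ℕ
open import Data.Product.Base using (∃; _×_; _,_; proj₁; proj₂)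
open import Data.Product.Properties using (≡-dec)
open import Data.Sum.Base using (_⊎_; [_,_]; swap)
open import Data.Vec.Base using (tabulate)
open import Function.Base using (id; _∘_)
open import Function.Bundles using (_⇔_)
open import Function.Definitions using (Injective)
open import Level using (0ℓ)
open import Relation.Binary.Core using (Rel)
open import Relation.Binary.Definitions using (Symmetric; Irreflexive)
  renaming (Decidable to Decidable₂)
open import Relation.Binary.PropositionalEquality
  using (_≡_; _≢_; refl; sym; trans; subst)
open import Relation.Nullary.Decidable
  using (Dec; yes; no; does; map′; True; toWitness; ¬?; _×-dec_; _→-dec_; _⊎-dec_)
open import Relation.Nullary.Negation using (¬_)
open import Relation.Unary using (Pred; Decidable)

record Graph : Set₁ where
  field
    order  : ℕ
    Adj    : Rel (Fin order) 0ℓ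
    adj?   : Decidable₂ Adj
    symm   : Symmetric Adj
    irrefl : Irreflexive _≡_ Adj

  Vertex : Set
  Vertex = Fin order

open Graph using (Vertex)

fromEdges : ∀ n (es : List (Fin n × Fin n))
            {loopless : True (All.all? (λ e → ¬? (proj₁ e ≟ proj₂ e)) es)} → Graph
fromEdges n es {loopless} = record
  { order  = n
  ; Adj    = λ u v → (u , v) ∈ es ⊎ (v , u) ∈ es
  ; adj?   = λ u v → ((u , v) ∈ₑ? es) ⊎-dec ((v , u) ∈ₑ? es)
  ; symm   = swap
  ; irrefl = λ { refl → [ noLoop , noLoop ] }
  }
  where
  open DecMembership (≡-dec _≟_ _≟_) using () renaming (_∈?_ to _∈ₑ?_)
  noLoop : ∀ {u} → ¬ ((u , u) ∈ es)
  noLoop uu∈es = All.lookup (toWitness loopless) uu∈es refl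

P₅ : Graph
P₅ = fromEdges 5 ((0F , 1F) ∷ (1F , 2F) ∷ (2F , 3F) ∷ (3F , 4F) ∷ [])

-- The vertices a, b, c, d, e are 0F, 1F, 2F, 3F, 4F; e is the pendant vertex.
Flagᶜ : Graph
Flagᶜ = fromEdges 5 ((0F , 1F) ∷ (1F , 2F) ∷ (2F , 3F) ∷ (3F , 0F) ∷ (0F , 4F) ∷ [])

-- An isomorphism from H onto an induced subgraph of G, the latter being the one
-- induced by the image of f.
record InducedCopy (H G : Graph) : Set where
  private
    module H = Graph H
    module G = Graph G
  field
    f         : Vertex H → Vertex G
    injective : Injective _≡_ _≡_ f
    adj⇔      : ∀ u v → H.Adj u v ⇔ G.Adj (f u) (f v)

infix 4 _-Free_

_-Free_ : Graph → Graph → Set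
H -Free G = ¬ InducedCopy H G

IsLeast : Pred ℕ 0ℓ → Pred ℕ 0ℓ
IsLeast P k = P k × (∀ {j} → P j → k ≤ j)

IsGreatest : Pred ℕ 0ℓ → Pred ℕ 0ℓ
IsGreatest P k = P k × (∀ {j} → P j → j ≤ k)

least : ∀ {P} → Decidable P → ∀ {m} → P m → ∃ (IsLeast P)
least         P? {zero}  p0 = zero , p0 , λ _ → z≤n
least {P = P} P? {suc m} pm with P? zero
... | yes p0 = zero , p0 , λ _ → z≤n
... | no ¬p0 with least (P? ∘ suc) pm
... | k , pk , k≤ = suc k , pk , λ {j} → bound {j}
  where
  bound : ∀ {j} → P j → suc k ≤ j
  bound {zero}  pj = ⊥-elim (¬p0 pj)
  bound {suc j} pj = s≤s (k≤ pj)

greatest : ∀ {P} → Decidable P → P 0 → ∀ m → (∀ {j} → P j → j ≤ m) → ∃ (IsGreatest P)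
greatest         P? p0 zero    ≤m = zero , p0 , ≤m
greatest {P = P} P? p0 (suc m) ≤m with P? (suc m)
... | yes pm = suc m , pm , ≤m
... | no ¬pm = greatest P? p0 m λ pj →
  ℕ.≤-pred (ℕ.≤∧≢⇒< (≤m pj) λ j≡ → ¬pm (subst P j≡ pj))

module _ (G : Graph) where
  open Graph G using (order; Adj; adj?; irrefl)

  neighbours : Vertex G → Subset order
  neighbours v = tabulate (does ∘ adj? v)

  degree : Vertex G → ℕ
  degree v = ∣ neighbours v ∣

  -- The graph without vertices gets maximum degree 0.
  Δ : ℕ
  Δ = max 0 (map degree (allFin order))

  IsClique : Subset order → Set
  IsClique S = ∀ u v → u Subset.∈ S → v Subset.∈ S → u ≢ v → Adj u v

  HasClique : ℕ → Set
  HasClique k = ∃ λ S → IsClique S × ∣ S ∣ ≡ k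

  hasClique? : Decidable HasClique
  hasClique? k = anySubset? λ S → clique? S ×-dec (∣ S ∣ ℕ.≟ k)
    where
    clique? : Decidable IsClique
    clique? S = all? λ u → all? λ v →
      (u ∈? S) →-dec ((v ∈? S) →-dec (¬? (u ≟ v) →-dec adj? u v))

  cliqueNumber : ∃ (IsGreatest HasClique)
  cliqueNumber = greatest hasClique?
    (Subset.⊥ , (λ _ _ u∈⊥ → ⊥-elim (∉⊥ u∈⊥)) , ∣⊥∣≡0 order)
    order λ { (S , _ , refl) → ∣p∣≤n S }

  ω : ℕ
  ω = proj₁ cliqueNumber

  IsColouring : ∀ {k} → (Vertex G → Fin k) → Set
  IsColouring c = ∀ u v → Adj u v → c u ≢ c v

  Colourable : ℕ → Set
  Colourable k = ∃ λ (c : Vertex G → Fin k) → IsColouring c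

  colourable? : Decidable Colourable
  colourable? k = map′
    (λ (i , ok) → finToFun i , ok)
    (λ (c , ok) → funToFin c , λ u v uv eq → ok u v uv
      (trans (sym (finToFun-funToFin c u)) (trans eq (finToFun-funToFin c v))))
    (any? λ i → all? λ u → all? λ v →
      adj? u v →-dec ¬? (finToFun {k} {order} i u ≟ finToFun i v))

  chromaticNumber : ∃ (IsLeast Colourable)
  chromaticNumber = least colourable? (id , λ u v uv u≡v → irrefl u≡v uv)

  χ : ℕ
  χ = proj₁ chromaticNumber

{-# OPTIONS --safe #-}

-- Let χ(G) = p + 1 and let W be a vertex-critical set: not p-colourable, but
-- p-colourable after deleting any vertex.  The proof has two halves.
--
-- W has no stable triple.  The component A of the complement graph containing such a
-- triple is again critical, so A is connected and has no clique cutset.  As A is also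
-- connected in the complement, it contains a P₃ and a vertex anticomplete to it.
-- Take a maximal connected non-clique D ⊆ A with a non-empty set M of vertices
-- anticomplete to D, and let N be the set of neighbours of D; maximality makes M
-- complete to N.  Forbidding P₅ and the banner, the vertices of N with a clique
-- neighbourhood in D form a clique B, the others form a clique K, and A has a clique
-- cutset K ∪ (B ∖ L) ∪ (D ∩ N(L)), for a suitable L ⊆ B.
--
-- If W has no stable triple, then colourings of W are matchings of the complement
-- graph, and criticality says that each vertex is missed by a maximum matching.
-- Gallai's exchange argument shows that, for a vertex x missed by a maximum matching,
-- the non-neighbours of x together with the other missed vertices form a clique,
-- whose size is at least 2p − deg x.
module Submission where

open import Defs
open import Data.Empty using (⊥; ⊥-elim)
open import Data.Fin.Base using (Fin; toℕ; fromℕ<; finToFun; funToFin)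
  renaming (_≤_ to _≤ᶠ_; _<_ to _<ᶠ_)
open import Data.Fin.Patterns using (0F; 1F; 2F; 3F; 4F)
import Data.Fin.Properties as Fin
open import Data.Fin.Subset as Subset using (Subset; ∣_∣)
open import Data.Fin.Subset.Properties using (x∈p⇒∣p-x∣<∣p∣; x∈p∧x≢y⇒x∈p-y)
open import Data.List.Base
  using (List; []; _∷_; [_]; _++_; length; filter; allFin; upTo; lookup; map)
open import Data.List.Extrema.Nat using (xs≤max)
open import Data.List.Membership.Propositional using (_∈_; _∉_)
open import Data.List.Membership.Propositional.Properties
  using ( ∈-map⁺; ∈-map⁻; ∈-++⁺ˡ; ∈-++⁺ʳ; ∈-++⁻; ∈-∃++; ∈-upTo⁺; ∈-upTo⁻
        ; ∈-filter⁺; ∈-filter⁻; ∈-lookup; ∈-allFin)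
import Data.List.Membership.DecPropositional as DecMembership
open import Data.List.Membership.Setoid.Properties using (index-injective)
open import Data.List.Properties using (length-++; length-map; length-upTo; length-tabulate)
open import Data.List.Relation.Binary.Permutation.Propositional.Properties using (shift; ↭-length)
open import Data.List.Relation.Unary.All as All using ([]; _∷_)
open import Data.List.Relation.Unary.AllPairs using ([]; _∷_)
open import Data.List.Relation.Unary.Any using (here; there; index)
open import Data.List.Relation.Unary.Unique.Propositional using (Unique)
open import Data.List.Relation.Unary.Unique.Propositional.Properties
  using (Unique[x∷xs]⇒x∉xs; ++⁺; map⁺; filter⁺; upTo⁺; allFin⁺)
open import Data.Nat.Base
  using (ℕ; zero; suc; _+_; _^_; _≤_; _<_; z≤n; s≤s; ⌊_/2⌋; ⌈_/2⌉)
open import Data.Nat.Properties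
open import Data.Product.Base using (∃; _×_; _,_; proj₁; proj₂)
open import Data.Sum.Base using (_⊎_; inj₁; inj₂)
open import Data.Sum.Properties using (inj₁-injective; inj₂-injective)
open import Data.Unit.Base using (⊤; tt)
open import Data.Vec.Base using (tabulate)
open import Data.Vec.Properties using (lookup⇒[]=; []=⇒lookup; lookup∘tabulate)
open import Function.Base using (id; _∘_; case_of_)
open import Function.Bundles using (_⇔_; mk⇔)
open import Level using (0ℓ)
open import Relation.Binary.Core using (Rel)
open import Relation.Binary.Definitions using (DecidableEquality; Symmetric)
open import Relation.Binary.PropositionalEquality hiding ([_])
open import Relation.Nullary.Decidable hiding (map)
open import Relation.Nullary.Negation using (¬_; contradiction)
open import Relation.Unary using (Pred; Decidable)

-- Counting and colouring

module Swap {A : Set} (_≟_ : DecidableEquality A) where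

  swap : A → A → A → A
  swap a b x with x ≟ a
  ... | yes _ = b
  ... | no  _ with x ≟ b
  ...   | yes _ = a
  ...   | no  _ = x

  swap-left : ∀ a b → swap a b a ≡ b
  swap-left a b with a ≟ a
  ... | yes _  = refl
  ... | no a≢a = contradiction refl a≢a

  swap-right : ∀ a b → swap a b b ≡ a
  swap-right a b with b ≟ a
  ... | yes b≡a = b≡a
  ... | no _ with b ≟ b
  ...   | yes _  = refl
  ...   | no b≢b = contradiction refl b≢b

  swap-other : ∀ {a b x} → x ≢ a → x ≢ b → swap a b x ≡ x
  swap-other {a} {b} {x} x≢a x≢b with x ≟ a
  ... | yes x≡a = contradiction x≡a x≢a
  ... | no _ with x ≟ b
  ...   | yes x≡b = contradiction x≡b x≢b
  ...   | no _    = refl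

  swap-involutive : ∀ a b x → swap a b (swap a b x) ≡ x
  swap-involutive a b x = case x ≟ a of λ where
    (yes refl) → trans (cong (swap a b) (swap-left a b)) (swap-right a b)
    (no x≢a) → case x ≟ b of λ where
      (yes refl) → trans (cong (swap a b) (swap-right a b)) (swap-left a b)
      (no x≢b) → trans (cong (swap a b) (swap-other x≢a x≢b)) (swap-other x≢a x≢b)

  swap-injective : ∀ a b {x y} → swap a b x ≡ swap a b y → x ≡ y
  swap-injective a b {x} {y} eq = begin
    x                     ≡⟨ swap-involutive a b x ⟨
    swap a b (swap a b x) ≡⟨ cong (swap a b) eq ⟩
    swap a b (swap a b y) ≡⟨ swap-involutive a b y ⟩
    y                     ∎
    where open ≡-Reasoning

  swap-preserves : (P : Pred A 0ℓ) → ∀ {a b} → P a → P b → ∀ {x} → P x → P (swap a b x)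
  swap-preserves P {a} {b} pa pb {x} px with x ≟ a
  ... | yes _ = pb
  ... | no _ with x ≟ b
  ...   | yes _ = pa
  ...   | no _  = px

-- Pigeonhole: each step deletes the image of the head from `ys`. Injectivity is asked only on
-- members of `xs`, so `f` may be arbitrary elsewhere.
length-≤ : ∀ {A B : Set} {xs : List A} {ys : List B} (f : A → B) → Unique xs →
           (∀ {x} → x ∈ xs → f x ∈ ys) →
           (∀ {x y} → x ∈ xs → y ∈ xs → f x ≡ f y → x ≡ y) →
           length xs ≤ length ys
length-≤ {xs = []}     f _ _ _ = z≤n
length-≤ {xs = x ∷ xs} f xs! into inj with ∈-∃++ (into (here refl))
... | ys , zs , refl = subst (suc (length xs) ≤_) (sym (↭-length (shift (f x) ys zs)))
    (s≤s (length-≤ f (tail xs!) into′ λ x∈ y∈ → inj (there x∈) (there y∈)))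
  where
  tail : Unique (x ∷ xs) → Unique xs
  tail (_ ∷ u) = u
  into′ : ∀ {z} → z ∈ xs → f z ∈ ys ++ zs
  into′ {z} z∈xs with ∈-++⁻ ys (into (there z∈xs))
  ... | inj₁ fz∈ys = ∈-++⁺ˡ fz∈ys
  ... | inj₂ (there fz∈zs) = ∈-++⁺ʳ ys fz∈zs
  ... | inj₂ (here fz≡fx) = contradiction
    (subst (_∈ xs) (inj (there z∈xs) (here refl) fz≡fx) z∈xs) (Unique[x∷xs]⇒x∉xs xs!)

∷-unique : ∀ {A : Set} {x : A} {xs} → x ∉ xs → Unique xs → Unique (x ∷ xs)
∷-unique {xs = xs} x∉ xs! = All.tabulate (λ y∈ x≡y → x∉ (subst (_∈ xs) (sym x≡y) y∈)) ∷ xs!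

⊆⇒length-≤ : ∀ {A : Set} {xs ys : List A} → Unique xs → (∀ {x} → x ∈ xs → x ∈ ys) →
             length xs ≤ length ys
⊆⇒length-≤ xs! xs⊆ys = length-≤ id xs! xs⊆ys (λ _ _ → id)

length-≤-order : ∀ {n} {xs : List (Fin n)} → Unique xs → length xs ≤ n
length-≤-order {n} {xs} xs! = subst (length xs ≤_) (length-tabulate {n = n} id)
  (⊆⇒length-≤ xs! (λ {x} _ → ∈-allFin x))

lookup-injective : ∀ {A : Set} {xs : List A} → Unique xs → ∀ {i j} → lookup xs i ≡ lookup xs j → i ≡ j
lookup-injective {xs = x ∷ xs} _ {Fin.zero} {Fin.zero} _ = refl
lookup-injective {xs = x ∷ xs} xs! {Fin.zero} {Fin.suc j} eq =
  contradiction (subst (_∈ xs) (sym eq) (∈-lookup j)) (Unique[x∷xs]⇒x∉xs xs!)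
lookup-injective {xs = x ∷ xs} xs! {Fin.suc i} {Fin.zero} eq =
  contradiction (subst (_∈ xs) eq (∈-lookup i)) (Unique[x∷xs]⇒x∉xs xs!)
lookup-injective {xs = x ∷ xs} (_ ∷ xs!) {Fin.suc i} {Fin.suc j} eq = cong Fin.suc (lookup-injective xs! eq)

-- Connectedness of the subgraph induced by P, for the edge relation R, as an
-- induction principle.
Connected : ∀ {A : Set} → Rel A 0ℓ → Pred A 0ℓ → Set₁
Connected {A} R P = (Q : Pred A 0ℓ) → (∀ {u v} → P u → P v → R u v → Q u → Q v) →
                ∀ {u v} → P u → P v → Q u → Q v

singleton-connected : ∀ {A : Set} {R : Rel A 0ℓ} {a} → Connected R (_∈ [ a ])
singleton-connected Q step (here refl) (here refl) q = q

∷-connected : ∀ {A : Set} {R : Rel A 0ℓ} → Symmetric R → ∀ {xs a b} →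
              b ∈ xs → R a b → Connected R (_∈ xs) → Connected R (_∈ a ∷ xs)
∷-connected sy b∈ ab conn Q step = λ where
    (here refl) (here refl) → id
    (here refl) (there v∈)  → conn Q step′ b∈ v∈ ∘ step (here refl) (there b∈) ab
    (there u∈)  (here refl) → step (there b∈) (here refl) (sy ab) ∘ conn Q step′ u∈ b∈
    (there u∈)  (there v∈)  → conn Q step′ u∈ v∈
  where step′ = λ {u} {v} u∈ v∈ → step {u} {v} (there u∈) (there v∈)

-- Each step adds a new element of `Fin n`, so at most `n` steps occur. The invariant is
-- universe-polymorphic because `Connected` lives in `Set₁`.
grow : ∀ {n} {ℓ ℓ′} (I : List (Fin n) → Set ℓ) (Done : List (Fin n) → Set ℓ′) →
       (∀ {xs} → I xs → Done xs ⊎ ∃ λ v → v ∉ xs × I (v ∷ xs)) →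
       ∀ {xs} → Unique xs → I xs → ∃ λ ys → I ys × Done ys
grow {n} I Done step {xs} = go n (m≤m+n n (length xs))
  where
  go : ∀ k {xs} → n ≤ k + length xs → Unique xs → I xs → ∃ λ ys → I ys × Done ys
  go k {xs} n≤ xs! i with step i
  ... | inj₁ done = xs , i , done
  ... | inj₂ (v , v∉xs , i′) with v∷xs! ← ∷-unique v∉xs xs! | k
  ...   | zero  = contradiction (≤-trans (length-≤-order v∷xs!) n≤) (<-irrefl refl)
  ...   | suc k = go k (subst (n ≤_) (sym (+-suc k (length xs))) n≤) v∷xs! i′

module Colouring (G : Graph) where
  open Graph G public renaming (Adj to infix 4 _~_)

  infix 4 _≁_
  _≁_ : Rel Vertex 0ℓ
  u ≁ v = ¬ u ~ v

  _-_ : Pred Vertex 0ℓ → Vertex → Pred Vertex 0ℓ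
  (P - v) u = P u × u ≢ v

  -- Colours are natural numbers constrained only on `P`, so that the same function serves every
  -- subset of `P`.
  Col : ℕ → Pred Vertex 0ℓ → Set
  Col q P = ∃ λ (c : Vertex → ℕ) →
    (∀ v → P v → c v < q) × (∀ u v → P u → P v → u ~ v → c u ≢ c v)

  Col-⊆ : ∀ {q P Q} → (∀ v → Q v → P v) → Col q P → Col q Q
  Col-⊆ Q⊆P (c , c< , proper) =
    c , (λ v → c< v ∘ Q⊆P v) , λ u v qu qv → proper u v (Q⊆P u qu) (Q⊆P v qv)

  Col? : ∀ q {P} → Decidable P → Dec (Col q P)
  Col? q {P} P? = map′ (λ (i , ok) → (λ v → toℕ (finToFun i v)) , ok) from
    -- One colour more than `q`: vertices outside `P` need a value even for `q` = 0, and `clip`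
    -- sends every colour above `q` to `q`.
    (Fin.any? λ (i : Fin (suc q ^ order)) →
      (Fin.all? λ v → P? v →-dec (toℕ (finToFun i v) <? q)) ×-dec
      (Fin.all? λ u → Fin.all? λ v → P? u →-dec (P? v →-dec (adj? u v →-dec
        ¬? (toℕ (finToFun {suc q} {order} i u) ≟ toℕ (finToFun i v))))))
    where
    from : Col q P → _
    from (c , c< , proper) = funToFin clip ,
        (λ v pv → subst (_< q) (sym (clip≡ v pv)) (c< v pv)) ,
        λ u v pu pv uv eq → proper u v pu pv uv (trans (sym (clip≡ u pu)) (trans eq (clip≡ v pv)))
      where
      clip : Vertex → Fin (suc q)
      clip v = fromℕ< (s≤s (m⊓n≤n (c v) q))
      clip≡ : ∀ v → P v → toℕ (finToFun (funToFin clip) v) ≡ c v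
      clip≡ v pv = trans (cong toℕ (Fin.finToFun-funToFin clip v))
        (trans (Fin.toℕ-fromℕ< _) (m≤n⇒m⊓n≡m (<⇒≤ (c< v pv))))

  Critical : ℕ → Pred Vertex 0ℓ → Set
  Critical q P = ¬ Col q P × (∀ {v} → P v → Col q (P - v))

  -- A vertex is deleted when the rest stays uncolourable. One pass suffices, since colourability of
  -- `Q - v` survives later deletions.
  critical-subset : ∀ {q P} → Decidable P → ¬ Col q P →
                    ∃ λ Q → Decidable Q × Critical q Q
  critical-subset {q} P? ¬col with go (allFin order)
    where
    go : (xs : List Vertex) → ∃ λ Q → Decidable Q × ¬ Col q Q ×
           (∀ {v} → v ∈ xs → Q v → Col q (Q - v))
    go [] = _ , P? , ¬col , λ ()
    go (x ∷ xs) with go xs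
    ... | Q , Q? , ¬colQ , crit with Col? q (λ u → Q? u ×-dec ¬? (u Fin.≟ x))
    ...   | yes col = Q , Q? , ¬colQ , λ where
              (here refl) _ → col
              (there v∈) → crit v∈
    ...   | no ¬col′ = Q - x , (λ u → Q? u ×-dec ¬? (u Fin.≟ x)) , ¬col′ , λ where
              (here refl) (_ , x≢x) → contradiction refl x≢x
              (there v∈) (qv , _) → Col-⊆ (λ u ((qu , _) , u≢v) → qu , u≢v) (crit v∈ qv)
  ... | Q , Q? , ¬colQ , crit = Q , Q? , ¬colQ , λ {v} → crit (∈-allFin v)

  open Swap _≟_

  module _ {q : ℕ} {Z : Pred Vertex 0ℓ} {c₁ c₂ : Vertex → ℕ}
           (c₁< : ∀ v → Z v → c₁ v < q) (c₂< : ∀ v → Z v → c₂ v < q)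
           (c₁-inj : ∀ {u v} → Z u → Z v → c₁ u ≡ c₁ v → u ≡ v)
           (c₂-inj : ∀ {u v} → Z u → Z v → c₂ u ≡ c₂ v → u ≡ v) where

    -- Built from one transposition of colours per vertex. Both colourings are injective on `Z`, so
    -- a later transposition leaves the colours already matched in place. As `π` is injective and
    -- respects the bound, composing with it keeps a `q`-colouring proper.
    rename-colours : (zs : List Vertex) → (∀ {z} → z ∈ zs → Z z) →
      ∃ λ (π : ℕ → ℕ) → (∀ {i} → i < q → π i < q) × (∀ {i j} → π i ≡ π j → i ≡ j) ×
        (∀ {z} → z ∈ zs → π (c₂ z) ≡ c₁ z)
    rename-colours [] _ = id , id , id , λ ()
    rename-colours (z ∷ zs) zs⊆Z with rename-colours zs (zs⊆Z ∘ there)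
    ... | π , π< , π-inj , ok = swap a b ∘ π ,
          (λ i< → swap-preserves (_< q) (π< (c₂< z zZ)) (c₁< z zZ) (π< i<)) ,
          π-inj ∘ swap-injective a b ,
          λ { (here refl) → swap-left a b ; (there u∈) → old u∈ }
      where
      zZ = zs⊆Z (here refl)
      a = π (c₂ z)
      b = c₁ z
      old : ∀ {u} → u ∈ zs → swap a b (π (c₂ u)) ≡ c₁ u
      old {u} u∈ with u Fin.≟ z
      ... | yes refl = swap-left a b
      ... | no u≢z = trans
        (swap-other (λ eq → u≢z (c₂-inj uZ zZ (π-inj eq)))
                    (λ eq → u≢z (c₁-inj uZ zZ (trans (sym (ok u∈)) eq))))
        (ok u∈)
        where uZ = zs⊆Z (there u∈)

  -- Both sides X ∪ Z and Y ∪ Z are colourable, where Z is the rest of A, and the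
  -- two colourings can be made to agree on the clique Z.
  no-clique-cutset : ∀ {q A X Y} → Critical q A → Decidable A → Decidable X → Decidable Y →
    (∀ {u v} → X u → Y v → u ≁ v) → (∀ {v} → X v → Y v → ⊥) →
    (∀ {u v} → A u → ¬ X u → ¬ Y u → A v → ¬ X v → ¬ Y v → u ≢ v → u ~ v) →
    ∀ {x y} → A x → X x → A y → Y y → ⊥
  no-clique-cutset {q} {A} {X} {Y} (¬col , crit) A? X? Y? XY disj Z-clique {x} {y} ax xx ay yy =
    case crit ay of λ where
      (c₁ , c₁< , proper₁) → case crit ax of λ where
        (c₂ , c₂< , proper₂) → glue c₁ c₁< proper₁ c₂ c₂< proper₂
    where
    Z : Pred Vertex 0ℓ
    Z v = A v × ¬ X v × ¬ Y v
    Z? : Decidable Z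
    Z? v = A? v ×-dec (¬? (X? v) ×-dec ¬? (Y? v))
    X⇒A-y : ∀ {v} → A v → ¬ Y v → (A - y) v
    X⇒A-y av ¬yv = av , λ { refl → ¬yv yy }
    Y⇒A-x : ∀ {v} → A v → ¬ X v → (A - x) v
    Y⇒A-x av ¬xv = av , λ { refl → ¬xv xx }
    glue : ∀ c₁ → (∀ v → (A - y) v → c₁ v < q) →
      (∀ u v → (A - y) u → (A - y) v → u ~ v → c₁ u ≢ c₁ v) →
      ∀ c₂ → (∀ v → (A - x) v → c₂ v < q) →
      (∀ u v → (A - x) u → (A - x) v → u ~ v → c₂ u ≢ c₂ v) → ⊥
    glue c₁ c₁< proper₁ c₂ c₂< proper₂
      with rename-colours {q} {Z} {c₁} {c₂}
             (λ v (av , _ , ¬yv) → c₁< v (X⇒A-y av ¬yv))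
             (λ v (av , ¬xv , _) → c₂< v (Y⇒A-x av ¬xv))
             (λ {u} {v} (au , ¬xu , ¬yu) (av , ¬xv , ¬yv) eq → decidable-stable (u Fin.≟ v) λ u≢v →
                proper₁ u v (X⇒A-y au ¬yu) (X⇒A-y av ¬yv) (Z-clique au ¬xu ¬yu av ¬xv ¬yv u≢v) eq)
             (λ {u} {v} (au , ¬xu , ¬yu) (av , ¬xv , ¬yv) eq → decidable-stable (u Fin.≟ v) λ u≢v →
                proper₂ u v (Y⇒A-x au ¬xu) (Y⇒A-x av ¬xv) (Z-clique au ¬xu ¬yu av ¬xv ¬yv u≢v) eq)
             (filter Z? (allFin order)) (λ z∈ → proj₂ (∈-filter⁻ Z? {xs = allFin order} z∈))
    ... | π , π< , π-inj , agree = ¬col (c , c< , proper)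
      where
      agree′ : ∀ {z} → Z z → π (c₂ z) ≡ c₁ z
      agree′ {z} zz = agree (∈-filter⁺ Z? (∈-allFin z) zz)
      c : Vertex → ℕ
      c v with X? v
      ... | yes _ = c₁ v
      ... | no _  = π (c₂ v)
      c< : ∀ v → A v → c v < q
      c< v av with X? v
      ... | yes xv = c₁< v (X⇒A-y av (disj xv))
      ... | no ¬xv = π< (c₂< v (Y⇒A-x av ¬xv))
      -- An edge leaving `X` cannot end in `Y`, so it ends in `Z`, where the renamed `c₂` agrees
      -- with `c₁`.
      mixed : ∀ {u v} → A u → A v → u ~ v → X u → ¬ X v → c₁ u ≢ π (c₂ v)
      mixed {u} {v} au av uv xu ¬xv eq =
        proper₁ u v (X⇒A-y au (disj xu)) (X⇒A-y av ¬yv) uv (trans eq (agree′ (av , ¬xv , ¬yv)))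
        where ¬yv = λ yv → XY xu yv uv
      proper : ∀ u v → A u → A v → u ~ v → c u ≢ c v
      proper u v au av uv with X? u | X? v
      ... | yes xu | yes xv = proper₁ u v (X⇒A-y au (disj xu)) (X⇒A-y av (disj xv)) uv
      ... | yes xu | no ¬xv = mixed au av uv xu ¬xv
      ... | no ¬xu | yes xv = mixed av au (symm uv) xv ¬xu ∘ sym
      ... | no ¬xu | no ¬xv = λ eq → proper₂ u v (Y⇒A-x au ¬xu) (Y⇒A-x av ¬xv) uv (π-inj eq)

  -- A closed `Q` splitting `A` would make the empty set a clique cutset between the parts of `A`
  -- inside and outside `Q`.
  critical⇒connected : ∀ {q A} → Critical q A → Decidable A →
    (Q : Pred Vertex 0ℓ) → Decidable Q → (∀ {u v} → A u → A v → u ~ v → Q u → Q v) →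
    ∀ {u v} → A u → A v → Q u → Q v
  critical⇒connected {A = A} crit A? Q Q? step {u} {v} au av qu = decidable-stable (Q? v) λ ¬qv →
    no-clique-cutset {X = λ w → A w × Q w} {Y = λ w → A w × ¬ Q w} crit A?
      (λ w → A? w ×-dec Q? w) (λ w → A? w ×-dec ¬? (Q? w))
      (λ (aw , qw) (aw′ , ¬qw′) ww′ → ¬qw′ (step aw aw′ ww′ qw))
      (λ (_ , qw) (_ , ¬qw) → ¬qw qw)
      (λ {w} aw ¬xw ¬yw → contradiction (λ qw → ¬xw (aw , qw)) λ ¬qw → ¬yw (aw , ¬qw))
      au (au , qu) av (av , ¬qv)

  -- Here `q` + 1 is the chromatic number of `A`. In a `p`-colouring of `W - v` the colours used on
  -- `A - v` do not occur outside `A`. If there are more than `q` of them, an optimal colouring of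
  -- `A` with these colours yields a `p`-colouring of `W`; otherwise renumbering them gives a
  -- `q`-colouring of `A - v`.
  critical-component : ∀ {p W A a} → Critical p W → Decidable W → Decidable A → (∀ {v} → A v → W v) →
    (∀ {u v} → A u → W v → ¬ A v → u ~ v) → A a → ∃ λ q → Critical q A
  critical-component {p} {W} {A} {a} (¬col , crit) W? A? A⊆W complete aa
    with least (λ k → Col? k A?) {order} ((toℕ , (λ v _ → Fin.toℕ<n v) , λ u v _ _ uv eq → irrefl (Fin.toℕ-injective eq) uv))
  ... | zero , (c , c< , _) , _ = contradiction (c< a aa) (λ ())
  ... | suc q , colA@(d , d< , proper-d) , minimal = q , (λ col → <-irrefl refl (minimal col)) , crit′
    where
    crit′ : ∀ {v} → A v → Col q (A - v)
    crit′ {v} av with crit (A⊆W av)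
    ... | c , c< , proper = case suc q ≤? length used of λ where
        (yes q<) → contradiction (recolour q<) ¬col
        (no q≮)  → compress (≮⇒≥ q≮)
      where
      Used : Pred ℕ 0ℓ
      Used i = ∃ λ u → (A - v) u × c u ≡ i
      Used? : Decidable Used
      Used? i = Fin.any? λ u → (A? u ×-dec ¬? (u Fin.≟ v)) ×-dec (c u ≟ i)
      used : List ℕ
      used = filter Used? (upTo p)
      used! : Unique used
      used! = filter⁺ Used? (upTo⁺ p)
      ∈used : ∀ {u} → (A - v) u → c u ∈ used
      ∈used {u} (au , u≢v) = ∈-filter⁺ Used? (∈-upTo⁺ (c< u (A⊆W au , u≢v))) (u , (au , u≢v) , refl)

      compress : length used ≤ q → Col q (A - v)
      compress ≤q = c′ , c′< , proper′
        where
        c′ : Vertex → ℕ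
        c′ u with A? u ×-dec ¬? (u Fin.≟ v)
        ... | yes au = toℕ (index (∈used au))
        ... | no _   = 0
        c′< : ∀ u → (A - v) u → c′ u < q
        c′< u au with A? u ×-dec ¬? (u Fin.≟ v)
        ... | yes au′ = <-≤-trans (Fin.toℕ<n (index (∈used au′))) ≤q
        ... | no ¬au  = contradiction au ¬au
        proper′ : ∀ u w → (A - v) u → (A - v) w → u ~ w → c′ u ≢ c′ w
        proper′ u w au aw uw with A? u ×-dec ¬? (u Fin.≟ v) | A? w ×-dec ¬? (w Fin.≟ v)
        ... | no ¬au | _ = contradiction au ¬au
        ... | yes _  | no ¬aw = contradiction aw ¬aw
        ... | yes au′@(a₁ , u≢v) | yes aw′@(a₂ , w≢v) = λ eq →
          proper u w (A⊆W a₁ , u≢v) (A⊆W a₂ , w≢v) uw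
            (index-injective (setoid ℕ) (∈used au′) (∈used aw′) (Fin.toℕ-injective eq))

      recolour : suc q ≤ length used → Col p W
      recolour q< = c′ , c′< , proper′
        where
        pick : ∀ {u} → A u → Fin (length used)
        pick {u} au = fromℕ< (≤-trans (d< u au) q<)
        pick-injective : ∀ {u w} (au : A u) (aw : A w) → lookup used (pick au) ≡ lookup used (pick aw) → d u ≡ d w
        pick-injective au aw eq = trans (sym (Fin.toℕ-fromℕ< _))
          (trans (cong toℕ (lookup-injective used! eq)) (Fin.toℕ-fromℕ< _))
        picked : ∀ {u} (au : A u) → Used (lookup used (pick au))
        picked au = proj₂ (∈-filter⁻ Used? {xs = upTo p} (∈-lookup (pick au)))
        c′ : Vertex → ℕ
        c′ u with A? u
        ... | yes au = lookup used (pick au)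
        ... | no _   = c u
        c′< : ∀ u → W u → c′ u < p
        c′< u wu with A? u
        ... | yes au = ∈-upTo⁻ (proj₁ (∈-filter⁻ Used? {xs = upTo p} (∈-lookup (pick au))))
        ... | no ¬au = c< u (wu , λ { refl → ¬au av })
        mixed : ∀ {u w} (au : A u) → W w → ¬ A w → lookup used (pick au) ≢ c w
        mixed {w = w} au ww ¬aw eq with picked au
        ... | t , (at , t≢v) , ct≡ = proper t w (A⊆W at , t≢v) (ww , λ { refl → ¬aw av })
                (complete at ww ¬aw) (trans ct≡ eq)
        proper′ : ∀ u w → W u → W w → u ~ w → c′ u ≢ c′ w
        proper′ u w wu ww uw with A? u | A? w
        ... | yes au | yes aw = λ eq → proper-d u w au aw uw (pick-injective au aw eq)
        ... | yes au | no ¬aw = mixed au ww ¬aw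
        ... | no ¬au | yes aw = mixed aw wu ¬au ∘ sym
        ... | no ¬au | no ¬aw = proper u w (wu , λ { refl → ¬au av }) (ww , λ { refl → ¬aw av }) uw

-- Critical vertex sets have no stable triple

module Structure (G : Graph) (P₅-free : P₅ -Free G) (banner-free : Flagᶜ -Free G) where
  open Colouring G

  module _ (H : Graph) (f : Graph.Vertex H → Vertex) where
    private module H = Graph H

    edge : ∀ {i j} {_ : True (H.adj? i j)} → f i ~ f j → H.Adj i j ⇔ f i ~ f j
    edge {_} {_} {t} e = mk⇔ (λ _ → e) (λ _ → toWitness t)

    non-edge : ∀ {i j} {_ : False (H.adj? i j)} → f i ≁ f j → H.Adj i j ⇔ f i ~ f j
    non-edge {_} {_} {t} e = mk⇔ (λ ij → contradiction ij (toWitnessFalse t)) (λ fij → contradiction fij e)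

  no-P₅ : ∀ {a b c d e} → a ~ b → b ~ c → c ~ d → d ~ e →
          a ≁ c → a ≁ d → a ≁ e → b ≁ d → b ≁ e → c ≁ e → ⊥
  no-P₅ {a} {b} {c} {d} {e} ab bc cd de ac ad ae bd be ce = P₅-free (record
    { f = f ; injective = lookup-injective vs! ; adj⇔ = adj⇔ })
    where
    vs : List Vertex
    vs = a ∷ b ∷ c ∷ d ∷ e ∷ []
    f : Fin 5 → Vertex
    f = lookup vs
    + = λ {i j} {t} → edge P₅ f {i} {j} {t}
    - = λ {i j} {t} → non-edge P₅ f {i} {j} {t}
    adj⇔ : ∀ i j → Graph.Adj P₅ i j ⇔ f i ~ f j
    adj⇔ 0F 0F = - (irrefl refl)
    adj⇔ 0F 1F = + ab
    adj⇔ 0F 2F = - ac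
    adj⇔ 0F 3F = - ad
    adj⇔ 0F 4F = - ae
    adj⇔ 1F 0F = + (symm ab)
    adj⇔ 1F 1F = - (irrefl refl)
    adj⇔ 1F 2F = + bc
    adj⇔ 1F 3F = - bd
    adj⇔ 1F 4F = - be
    adj⇔ 2F 0F = - (ac ∘ symm)
    adj⇔ 2F 1F = + (symm bc)
    adj⇔ 2F 2F = - (irrefl refl)
    adj⇔ 2F 3F = + cd
    adj⇔ 2F 4F = - ce
    adj⇔ 3F 0F = - (ad ∘ symm)
    adj⇔ 3F 1F = - (bd ∘ symm)
    adj⇔ 3F 2F = + (symm cd)
    adj⇔ 3F 3F = - (irrefl refl)
    adj⇔ 3F 4F = + de
    adj⇔ 4F 0F = - (ae ∘ symm)
    adj⇔ 4F 1F = - (be ∘ symm)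
    adj⇔ 4F 2F = - (ce ∘ symm)
    adj⇔ 4F 3F = + (symm de)
    adj⇔ 4F 4F = - (irrefl refl)
    vs! : Unique vs
    vs! = ((λ { refl → irrefl refl ab }) ∷ (λ { refl → ad cd }) ∷ (λ { refl → ac (symm cd) }) ∷ (λ { refl → ad (symm de) }) ∷ [])
        ∷ ((λ { refl → irrefl refl bc }) ∷ (λ { refl → be de }) ∷ (λ { refl → bd (symm de) }) ∷ [])
        ∷ ((λ { refl → irrefl refl cd }) ∷ (λ { refl → be bc }) ∷ [])
        ∷ ((λ { refl → irrefl refl de }) ∷ [])
        ∷ [] ∷ []

  -- The vertices `b` and `d` are twins in the banner, hence the hypothesis `b ≢ d`; every other
  -- pair is told apart by adjacencies.
  no-banner : ∀ {a b c d e} → a ~ b → b ~ c → c ~ d → d ~ a → a ~ e →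
              b ≢ d → a ≁ c → b ≁ d → b ≁ e → c ≁ e → d ≁ e → ⊥
  no-banner {a} {b} {c} {d} {e} ab bc cd da ae b≢d ac bd be ce de = banner-free (record
    { f = f ; injective = lookup-injective vs! ; adj⇔ = adj⇔ })
    where
    vs : List Vertex
    vs = a ∷ b ∷ c ∷ d ∷ e ∷ []
    f : Fin 5 → Vertex
    f = lookup vs
    + = λ {i j} {t} → edge Flagᶜ f {i} {j} {t}
    - = λ {i j} {t} → non-edge Flagᶜ f {i} {j} {t}
    adj⇔ : ∀ i j → Graph.Adj Flagᶜ i j ⇔ f i ~ f j
    adj⇔ 0F 0F = - (irrefl refl)
    adj⇔ 0F 1F = + ab
    adj⇔ 0F 2F = - ac
    adj⇔ 0F 3F = + (symm da)
    adj⇔ 0F 4F = + ae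
    adj⇔ 1F 0F = + (symm ab)
    adj⇔ 1F 1F = - (irrefl refl)
    adj⇔ 1F 2F = + bc
    adj⇔ 1F 3F = - bd
    adj⇔ 1F 4F = - be
    adj⇔ 2F 0F = - (ac ∘ symm)
    adj⇔ 2F 1F = + (symm bc)
    adj⇔ 2F 2F = - (irrefl refl)
    adj⇔ 2F 3F = + cd
    adj⇔ 2F 4F = - ce
    adj⇔ 3F 0F = + da
    adj⇔ 3F 1F = - (bd ∘ symm)
    adj⇔ 3F 2F = + (symm cd)
    adj⇔ 3F 3F = - (irrefl refl)
    adj⇔ 3F 4F = - de
    adj⇔ 4F 0F = + (symm ae)
    adj⇔ 4F 1F = - (be ∘ symm)
    adj⇔ 4F 2F = - (ce ∘ symm)
    adj⇔ 4F 3F = - (de ∘ symm)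
    adj⇔ 4F 4F = - (irrefl refl)
    vs! : Unique vs
    vs! = ((λ { refl → irrefl refl ab }) ∷ (λ { refl → ce ae }) ∷ (λ { refl → irrefl refl da }) ∷ (λ { refl → irrefl refl ae }) ∷ [])
        ∷ ((λ { refl → irrefl refl bc }) ∷ b≢d ∷ (λ { refl → ce (symm bc) }) ∷ [])
        ∷ ((λ { refl → irrefl refl cd }) ∷ (λ { refl → be bc }) ∷ [])
        ∷ ((λ { refl → ce cd }) ∷ [])
        ∷ [] ∷ []

  adjacent : ∀ {u v} → (u ≁ v → ⊥) → u ~ v
  adjacent {u} {v} = decidable-stable (adj? u v)

  Clique : Pred Vertex 0ℓ → Set
  Clique P = ∀ u v → P u → P v → u ≢ v → u ~ v

  clique? : ∀ {P} → Decidable P → Dec (Clique P)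
  clique? P? = Fin.all? λ u → Fin.all? λ v → P? u →-dec (P? v →-dec (¬? (u Fin.≟ v) →-dec adj? u v))

  module Boundary {A D : Pred Vertex 0ℓ} (A? : Decidable A) (D? : Decidable D) where

    Touches : Pred Vertex 0ℓ
    Touches v = ∃ λ d → D d × v ~ d

    touches? : Decidable Touches
    touches? v = Fin.any? λ d → D? d ×-dec adj? v d

    N M : Pred Vertex 0ℓ
    N v = A v × ¬ D v × Touches v
    M v = A v × ¬ D v × ¬ Touches v

    N? : Decidable N
    N? v = A? v ×-dec (¬? (D? v) ×-dec touches? v)

    M? : Decidable M
    M? v = A? v ×-dec (¬? (D? v) ×-dec ¬? (touches? v))

  -- The clique cutset around a connected non-clique

  module Separation {q : ℕ} {A D : Pred Vertex 0ℓ} (A? : Decidable A) (D? : Decidable D)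
    (critical : Critical q A) (co-connected : Connected _≁_ A)
    (D⊆A : ∀ {v} → D v → A v) (D-connected : Connected _~_ D) (D-nonclique : ¬ Clique D) where

    open Boundary A? D?

    module _ (M-N-complete : ∀ {m n} → M m → N n → m ~ n) {x : Vertex} (Mx : M x) where

      xN : ∀ {t} → N t → x ~ t
      xN = M-N-complete Mx

      xD : ∀ {d} → D d → x ≁ d
      xD {d} dd xd = proj₂ (proj₂ Mx) (d , dd , xd)

      x≢D : ∀ {d} → D d → x ≢ d
      x≢D dd refl = proj₁ (proj₂ Mx) dd

      -- Otherwise the cycle `t`, `x`, `t′`, `d` with `e` pendant at `t` is a banner.
      common~private : ∀ {t t′ d e} → N t → N t′ → t ≁ t′ →
        D d → t ~ d → t′ ~ d → D e → t ~ e → t′ ≁ e → d ~ e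
      common~private nt nt′ tt′ dd td t′d de te t′e = adjacent λ d≁e →
        no-banner (symm (xN nt)) (xN nt′) t′d (symm td) te (x≢D dd) tt′ (xD dd) (xD de) t′e d≁e

      -- Otherwise `e`, `t`, `x`, `t′`, `w` is an induced `P₅`.
      private~private : ∀ {t t′ e w} → N t → N t′ → t ≁ t′ →
        D e → t ~ e → t′ ≁ e → D w → t′ ~ w → t ≁ w → e ~ w
      private~private nt nt′ tt′ de te t′e dw t′w tw = adjacent λ e≁w →
        no-P₅ (symm te) (symm (xN nt)) (xN nt′) t′w (xD de ∘ symm) (t′e ∘ symm) e≁w tt′ tw (xD dw)

      -- Otherwise the cycle `t`, `p`, `f`, `q` with `x` pendant at `t` is a banner.
      shared-clique : ∀ {t f p q} → N t → D f → t ≁ f →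
        D p → t ~ p → f ~ p → D q → t ~ q → f ~ q → p ≢ q → p ~ q
      shared-clique nt df tf dp tp fp dq tq fq p≢q = adjacent λ p≁q →
        no-banner tp (symm fp) fq (symm tq) (symm (xN nt)) p≢q tf p≁q (xD dp ∘ symm) (xD df ∘ symm) (xD dq ∘ symm)

      -- The cycle `g`, `t`, `x`, `t′` with `v` pendant at `g` would be a banner.
      neighbours-in-N∪ : ∀ {t t′ g v} → N t → N t′ → t ≢ t′ → t ≁ t′ →
        D g → t ~ g → t′ ~ g → D v → g ~ v → t ≁ v → t′ ≁ v → ⊥
      neighbours-in-N∪ nt nt′ t≢t′ tt′ dg tg t′g dv gv tv t′v =
        no-banner (symm tg) (symm (xN nt)) (xN nt′) t′g gv t≢t′ (xD dg ∘ symm) tt′ tv (xD dv) t′v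

      ND : Vertex → Pred Vertex 0ℓ
      ND t u = D u × t ~ u

      ND? : ∀ t → Decidable (ND t)
      ND? t u = D? u ×-dec adj? t u

      -- The private neighbour `e` of `t` is adjacent to every neighbour of `t′` in `D`, common or
      -- private, so `shared-clique` applies with `e` as the second centre.
      not-contained⇒clique : ∀ {t t′ e} → N t → N t′ → t ≁ t′ → D e → t ~ e → t′ ≁ e → Clique (ND t′)
      not-contained⇒clique {t} {t′} {e} nt nt′ tt′ de te t′e p q (dp , t′p) (dq , t′q) =
        shared-clique nt′ de t′e dp t′p (e~ dp t′p) dq t′q (e~ dq t′q)
        where
        e~ : ∀ {p} → D p → t′ ~ p → e ~ p
        e~ {p} dp t′p with adj? t p
        ... | yes tp = symm (common~private nt nt′ tt′ dp tp t′p de te t′e)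
        ... | no  tp = private~private nt nt′ tt′ de te t′e dp t′p tp

      -- With disjoint neighbourhoods, `t` and `t′` together cover `D`: an uncovered `v` next to a
      -- covered `u` starts a `P₅` through `x`. Then `private~private` and `shared-clique` turn `D`
      -- into a clique.
      common-neighbour : ∀ {t t′} → N t → N t′ → t ≁ t′ → (∀ {d} → D d → t ~ d → t′ ~ d → ⊥) → ⊥
      common-neighbour {t} {t′} nt@(_ , _ , e , de , te) nt′@(_ , _ , w , dw , t′w) tt′ disjoint =
        D-nonclique λ f f′ df df′ f≢f′ → case covered df , covered df′ of λ where
          (inj₁ tf , inj₁ tf′)   → same nt nt′ tt′ disjoint tf tf′ df df′ f≢f′ dw t′w
          (inj₂ t′f , inj₂ t′f′) → same nt′ nt (tt′ ∘ symm) (λ d a b → disjoint d b a) t′f t′f′ df df′ f≢f′ de te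
          (inj₁ tf , inj₂ t′f′)  → cross df tf df′ t′f′
          (inj₂ t′f , inj₁ tf′)  → symm (cross df′ tf′ df t′f)
        where
        covered : ∀ {f} → D f → t ~ f ⊎ t′ ~ f
        covered df = D-connected (λ f → t ~ f ⊎ t′ ~ f) step de df (inj₁ te)
          where
          step : ∀ {u v} → D u → D v → u ~ v → t ~ u ⊎ t′ ~ u → t ~ v ⊎ t′ ~ v
          step {u} {v} du dv uv ev with adj? t v | adj? t′ v
          ... | yes tv | _ = inj₁ tv
          ... | no _ | yes t′v = inj₂ t′v
          ... | no tv | no t′v = ⊥-elim (case ev of λ where
            (inj₁ tu) → no-P₅ (symm uv) (symm tu) (symm (xN nt)) (xN nt′)
              (tv ∘ symm) (xD dv ∘ symm) (t′v ∘ symm) (xD du ∘ symm) (λ ut′ → disjoint du tu (symm ut′)) tt′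
            (inj₂ t′u) → no-P₅ (symm uv) (symm t′u) (symm (xN nt′)) (xN nt)
              (t′v ∘ symm) (xD dv ∘ symm) (tv ∘ symm) (xD du ∘ symm) (λ ut → disjoint du (symm ut) t′u) (tt′ ∘ symm))
        cross : ∀ {f f′} → D f → t ~ f → D f′ → t′ ~ f′ → f ~ f′
        cross df tf df′ t′f′ = private~private nt nt′ tt′ df tf (disjoint df tf) df′ t′f′ (λ tf′ → disjoint df′ tf′ t′f′)
        same : ∀ {t t′ f f′ w} → N t → N t′ → t ≁ t′ → (∀ {d} → D d → t ~ d → t′ ~ d → ⊥) →
          t ~ f → t ~ f′ → D f → D f′ → f ≢ f′ → D w → t′ ~ w → f ~ f′
        same nt nt′ tt′ disjoint tf tf′ df df′ f≢f′ dw t′w = shared-clique nt dw tw df tf (symm (~w df tf)) df′ tf′ (symm (~w df′ tf′)) f≢f′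
          where
          tw = λ tw → disjoint dw tw t′w
          ~w : ∀ {f} → D f → _ ~ f → f ~ _
          ~w df tf = private~private nt nt′ tt′ df tf (disjoint df tf) dw t′w tw

      B K : Pred Vertex 0ℓ
      B t = N t × Clique (ND t)
      K t = N t × ¬ Clique (ND t)

      B? : Decidable B
      B? t = N? t ×-dec clique? (ND? t)

      K? : Decidable K
      K? t = N? t ×-dec ¬? (clique? (ND? t))

      -- Neither neighbourhood in `D` is a clique, so by `not-contained⇒clique` the two coincide. By
      -- `neighbours-in-N∪` no edge of `D` leaves this common neighbourhood, which is therefore all
      -- of the connected `D`.
      K-complete-D : ∀ {k k′} → K k → K k′ → k ≢ k′ → k ≁ k′ → ∀ {d} → D d → k ~ d
      K-complete-D {k} {k′} (nk@(_ , _ , e , de , ke) , ncl) (nk′ , ncl′) k≢k′ kk′ dd =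
        D-connected (k ~_) step de dd ke
        where
        step : ∀ {u v} → D u → D v → u ~ v → k ~ u → k ~ v
        step du dv uv ku = adjacent λ kv → neighbours-in-N∪ nk nk′ k≢k′ kk′ du ku
          (adjacent λ k′u → ncl′ (not-contained⇒clique nk nk′ kk′ du ku k′u)) dv uv kv
          (λ k′v → ncl (not-contained⇒clique nk′ nk (kk′ ∘ symm) dv k′v kv))

      -- The set `X` of members of `K` with a non-neighbour in `K` is closed under non-adjacency
      -- within `A`. If it were non-empty, co-connectedness would put a vertex of `D` into it,
      -- although `K` is disjoint from `D`.
      K-clique : Clique K
      K-clique k₀ k₀′ kk₀ kk₀′ k₀≢k₀′ = adjacent λ k₀≁k₀′ →
        proj₁ (proj₂ (proj₁ (proj₁ (co-connected X step (proj₁ (proj₁ kk₀)) (D⊆A dd) (kk₀ , k₀′ , kk₀′ , k₀≢k₀′ , k₀≁k₀′))))) dd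
        where
        dd = proj₁ (proj₂ (proj₂ (proj₂ (proj₁ kk₀))))
        X : Pred Vertex 0ℓ
        X k = K k × ∃ λ k′ → K k′ × k ≢ k′ × k ≁ k′
        step : ∀ {u v} → A u → A v → u ≁ v → X u → X v
        step {u} {v} au av u≁v xu@(ku@(nu , _) , t , kt@(nt , _) , u≢t , u≁t) with u Fin.≟ v
        ... | yes refl = xu
        ... | no u≢v with D? v
        ...   | yes dv = contradiction (K-complete-D ku kt u≢t u≁t dv) u≁v
        ...   | no ¬dv with touches? v
        ...     | no ¬tv = contradiction (symm (M-N-complete (av , ¬dv , ¬tv) nu)) u≁v
        ...     | yes tv with clique? (ND? v)
        ...       | no ¬cl = ((av , ¬dv , tv) , ¬cl) , u , ku , u≢v ∘ sym , u≁v ∘ symm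
        -- Here `v` is in `B`. If `v` misses `t`, the cycles `x`, `u`, `d`, `t` with `v` pendant at
        -- `x` force `v` to be complete to `D`. If `v` sees `t`, non-adjacent `g`, `g′` give the
        -- cycle `t`, `g`, `u`, `g′` with `v` pendant at `t`.
        ...       | yes cl = ⊥-elim (D-nonclique case-t)
          where
          nv : N v
          nv = av , ¬dv , tv
          uD : ∀ {d} → D d → u ~ d
          uD = K-complete-D ku kt u≢t u≁t
          tD : ∀ {d} → D d → t ~ d
          tD = K-complete-D kt ku (u≢t ∘ sym) (u≁t ∘ symm)
          case-t : Clique D
          case-t g g′ dg dg′ g≢g′ with adj? v t
          ... | no v≁t = cl g g′ (dg , v~ dg) (dg′ , v~ dg′) g≢g′
            where
            v~ : ∀ {d} → D d → v ~ d
            v~ dd = adjacent λ vd → no-banner (xN nu) (uD dd) (symm (tD dd)) (symm (xN nt)) (xN nv)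
              u≢t (xD dd) u≁t u≁v (vd ∘ symm) (v≁t ∘ symm)
          ... | yes v~t = adjacent λ g≁g′ →
            no-banner (tD dg) (symm (uD dg)) (uD dg′) (symm (tD dg′)) (symm v~t) g≢g′ (u≁t ∘ symm) g≁g′
              (λ gv → g≁g′ (v-nbr g≁g′ dg dg′ g≢g′ gv)) u≁v (λ g′v → g≁g′ (symm (v-nbr (g≁g′ ∘ symm) dg′ dg (g≢g′ ∘ sym) g′v)))
            where
            v-nbr : ∀ {g g′} → g ≁ g′ → D g → D g′ → g ≢ g′ → g ~ v → g ~ g′
            v-nbr {g} {g′} g≁g′ dg dg′ g≢g′ gv with adj? v g′
            ... | yes vg′ = cl g g′ (dg , symm gv) (dg′ , vg′) g≢g′
            ... | no vg′ = common~private nu nv u≁v dg (uD dg) (symm gv) dg′ (uD dg′) vg′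

      -- Non-adjacent `b`, `b′` have a common neighbour `z` in `D`, and the union `U` of their
      -- neighbourhoods in `D` is a clique. All of `D` lies within distance one of `z`, hence in `U`
      -- by `next`, so `D` would be a clique.
      B-clique : Clique B
      B-clique b b′ (nb , cl) (nb′ , cl′) b≢b′ = adjacent λ b≁b′ →
        common-neighbour nb nb′ b≁b′ λ dz bz b′z → D-nonclique (D-clique b≁b′ dz bz b′z)
        where
        U : Pred Vertex 0ℓ
        U u = D u × (b ~ u ⊎ b′ ~ u)
        module _ (b≁b′ : b ≁ b′) where
          U-clique : Clique U
          U-clique p q (dp , inj₁ bp) (dq , inj₁ bq) p≢q = cl p q (dp , bp) (dq , bq) p≢q
          U-clique p q (dp , inj₂ b′p) (dq , inj₂ b′q) p≢q = cl′ p q (dp , b′p) (dq , b′q) p≢q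
          U-clique p q (dp , inj₁ bp) (dq , inj₂ b′q) p≢q with adj? b q | adj? b′ p
          ... | yes bq | _ = cl p q (dp , bp) (dq , bq) p≢q
          ... | no _ | yes b′p = cl′ p q (dp , b′p) (dq , b′q) p≢q
          ... | no bq | no b′p = private~private nb nb′ b≁b′ dp bp b′p dq b′q bq
          U-clique p q (dp , inj₂ b′p) (dq , inj₁ bq) p≢q with adj? b p | adj? b′ q
          ... | yes bp | _ = cl p q (dp , bp) (dq , bq) p≢q
          ... | no _ | yes b′q = cl′ p q (dp , b′p) (dq , b′q) p≢q
          ... | no bp | no b′q = symm (private~private nb nb′ b≁b′ dq bq b′q dp b′p bp)

          -- The banner in b x b′ g with pendant v.
          next : ∀ {g v} → D g → b ~ g → b′ ~ g → D v → g ~ v → U v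
          next {g} {v} dg bg b′g dv gv with adj? b v | adj? b′ v
          ... | yes bv | _ = dv , inj₁ bv
          ... | no _ | yes b′v = dv , inj₂ b′v
          ... | no bv | no b′v = ⊥-elim (neighbours-in-N∪ nb nb′ b≢b′ b≁b′ dg bg b′g dv gv bv b′v)

          module _ {z : Vertex} (dz : D z) (bz : b ~ z) (b′z : b′ ~ z) where
            near : ∀ {p} → D p → p ≡ z ⊎ z ~ p
            near dp = D-connected (λ p → p ≡ z ⊎ z ~ p) step dz dp (inj₁ refl)
              where
              step : ∀ {u v} → D u → D v → u ~ v → u ≡ z ⊎ z ~ u → v ≡ z ⊎ z ~ v
              step _ _ uv (inj₁ refl) = inj₂ uv
              step {u} {v} du dv uv (inj₂ zu) with v Fin.≟ z | adj? z v
              ... | yes v≡z | _ = inj₁ v≡z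
              ... | no _ | yes zv = inj₂ zv
              ... | no v≢z | no zv = ⊥-elim far
                where
                v∉U : ¬ U v
                v∉U uv′ = zv (U-clique z v (dz , inj₁ bz) uv′ (v≢z ∘ sym))
                bv : b ≁ v
                bv bv = v∉U (dv , inj₁ bv)
                b′v : b′ ≁ v
                b′v b′v = v∉U (dv , inj₂ b′v)
                far : ⊥
                -- If `u` sees exactly one of `b`, `b′`, then `v`, `u`, `z`, the other one and `x`
                -- form a `P₅`.
                far with adj? b u | adj? b′ u
                ... | yes bu | yes b′u = v∉U (next du bu b′u dv uv)
                ... | yes bu | no b′u = no-P₅ (symm uv) (symm zu) (symm b′z) (symm (xN nb′))
                  (zv ∘ symm) (b′v ∘ symm) (xD dv ∘ symm) (b′u ∘ symm) (xD du ∘ symm) (xD dz ∘ symm)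
                ... | no bu | yes b′u = no-P₅ (symm uv) (symm zu) (symm bz) (symm (xN nb))
                  (zv ∘ symm) (bv ∘ symm) (xD dv ∘ symm) (bu ∘ symm) (xD du ∘ symm) (xD dz ∘ symm)
                ... | no bu | no b′u = case next dz bz b′z du zu of λ where
                  (_ , inj₁ bu′) → bu bu′
                  (_ , inj₂ b′u′) → b′u b′u′

            D-clique : Clique D
            D-clique p q dp dq = U-clique p q (inU dp) (inU dq)
              where
              inU : ∀ {p} → D p → U p
              inU dp with near dp
              ... | inj₁ refl = dz , inj₁ bz
              ... | inj₂ zp = next dz bz b′z dp zp

      contained : ∀ {b k u} → B b → K k → b ≁ k → D u → b ~ u → k ~ u
      contained (nb , _) (nk , ncl) bk du bu = adjacent λ ku →
        ncl (not-contained⇒clique nb nk bk du bu ku)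

      contained~rest : ∀ {b k u e} → B b → K k → b ≁ k → D u → b ~ u → D e → k ~ e → b ≁ e → u ~ e
      contained~rest bb kk bk du bu de ke be =
        common~private (proj₁ kk) (proj₁ bb) (bk ∘ symm) du (contained bb kk bk du bu) bu de ke be

      -- If every neighbour of `k` in `D` were adjacent to `u`, then `shared-clique` would make
      -- `ND k` a clique. In continuation form, this supplies a neighbour `g` of `k` that misses
      -- `u`.
      avoiding : ∀ {k u} → K k → D u → k ≁ u → (∀ {g} → D g → k ~ g → g ≁ u → g ≢ u → ⊥) → ⊥
      avoiding (nk , ncl) du ku none = ncl λ p q (dp , kp) (dq , kq) →
        shared-clique nk du ku dp kp (u~ dp kp) dq kq (u~ dq kq)
        where
        u~ : ∀ {g} → D g → _ ~ g → _ ~ g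
        u~ dg kg = adjacent λ ug → none dg kg (ug ∘ symm) λ { refl → ku kg }

      -- For `b` and `β` in `B`, whose own neighbourhoods in `D` are cliques, this says that the
      -- union of these neighbourhoods is a clique.
      Merges : Vertex → Vertex → Set
      Merges b β = ∀ u w → D u → D w → b ~ u → β ~ w → u ≢ w → u ~ w

      merges? : ∀ b β → Dec (Merges b β)
      merges? b β = Fin.all? λ u → Fin.all? λ w → D? u →-dec (D? w →-dec
        (adj? b u →-dec (adj? β w →-dec (¬? (u Fin.≟ w) →-dec adj? u w))))

      -- The vertices of B that a clique cutset can leave out in exchange for their
      -- neighbours in D.
      L : Pred Vertex 0ℓ
      L b = B b × (∀ β → B β → Merges b β) × (∀ k u → K k → D u → b ~ u → k ~ u)

      L? : Decidable L
      L? b = B? b ×-dec ((Fin.all? λ β → B? β →-dec merges? b β) ×-dec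
        (Fin.all? λ k → Fin.all? λ u → K? k →-dec (D? u →-dec (adj? b u →-dec adj? k u))))

      -- This makes the vertices of `B` outside `L` complete to `K`. A failure of `merges` gives the
      -- cycle `β`, `b`, `u`, `k` with `w` pendant at `β`; a failure of `complete` gives `k′`, `b`,
      -- `u`, `k` with `g` pendant at `k′`.
      not-complete-K⇒L : ∀ {b k} → B b → K k → b ≁ k → L b
      not-complete-K⇒L {b} {k} bb@(nb , cl) kk bk = bb , merges , complete
        where
        k≢b : k ≢ b
        k≢b refl = proj₂ kk cl
        merges : ∀ β → B β → Merges b β
        merges β bβ@(nβ , clβ) u w du dw bu βw u≢w = adjacent λ uw →
          let βu = λ βu → uw (clβ u w (du , βu) (dw , βw) u≢w)
              bw = λ bw → uw (cl u w (du , bu) (dw , bw) u≢w)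
              kw = λ kw → uw (contained~rest bb kk bk du bu dw kw bw)
              b~β = B-clique b β bb bβ λ { refl → βu bu }
              β~k = adjacent λ βk → kw (contained bβ kk βk dw βw)
          in no-banner (symm b~β) bu (symm (contained bb kk bk du bu)) (symm β~k) βw
               (k≢b ∘ sym) βu bk bw uw kw
        complete : ∀ k′ u → K k′ → D u → b ~ u → k′ ~ u
        complete k′ u kk′ du bu = adjacent λ k′u → avoiding kk′ du k′u λ {g} dg k′g gu g≢u →
          let bk′ = adjacent λ bk′ → k′u (contained bb kk′ bk′ du bu)
              bg = λ bg → gu (cl g u (dg , bg) (du , bu) g≢u)
              ku = contained bb kk bk du bu
              k′k = K-clique k′ k kk′ kk λ { refl → k′u ku }
              kg = λ kg → gu (symm (contained~rest bb kk bk du bu dg kg bg))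
          in no-banner (symm bk′) bu (symm ku) (symm k′k) k′g (k≢b ∘ sym) k′u bk bg (gu ∘ symm) kg

      -- This makes the vertices of `B` outside `L` complete to the part of `LD` in `D`. The banners
      -- lie on the cycle `u`, `b`, `β`, `w`, with `w′` or `g` pendant at `u`; that `u` sees `g`
      -- comes from the cycle `k`, `β`, `w`, `u` with `g` pendant at `k`.
      L-closed : ∀ {b u β} → L b → D u → b ~ u → B β → β ≁ u → L β
      L-closed {b} {u} {β} (bb , merges , complete) du bu bβ@(nβ , clβ) βu = bβ , merges′ , complete′
        where
        b~β : b ~ β
        b~β = B-clique b β bb bβ λ { refl → βu bu }
        merges′ : ∀ β′ → B β′ → Merges β β′
        merges′ β′ bβ′ w w′ dw dw′ βw β′w′ w≢w′ = adjacent λ ww′ →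
          let uw = merges β bβ u w du dw bu βw λ { refl → βu βw }
              bw = λ bw → ww′ (merges β′ bβ′ w w′ dw dw′ bw β′w′ w≢w′)
              uw′ = merges β′ bβ′ u w′ du dw′ bu β′w′ λ { refl → ww′ (symm uw) }
              βw′ = λ βw′ → ww′ (clβ w w′ (dw , βw) (dw′ , βw′) w≢w′)
              bw′ = λ bw′ → ww′ (symm (merges β bβ w′ w dw′ dw bw′ βw (w≢w′ ∘ sym)))
          in no-banner (symm bu) b~β βw (symm uw) uw′ (λ { refl → proj₁ (proj₂ (proj₁ bb)) dw }) (βu ∘ symm) bw bw′ βw′ ww′
        complete′ : ∀ k w → K k → D w → β ~ w → k ~ w
        complete′ k w kk dw βw = adjacent λ kw → avoiding kk dw kw λ {g} dg kg gw g≢w →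
          let ku = complete k u kk du bu
              uw = merges β bβ u w du dw bu βw λ { refl → βu βw }
              kβ = adjacent λ kβ → kw (contained bβ kk (kβ ∘ symm) dw βw)
              βg = λ βg → gw (clβ g w (dg , βg) (dw , βw) g≢w)
              bw = λ bw → kw (complete k w kk dw bw)
              bg = λ bg → gw (merges β bβ g w dg dw bg βw g≢w)
              ug = adjacent λ ug → no-banner kβ βw (symm uw) (symm ku) kg (λ { refl → proj₁ (proj₂ nβ) du }) kw βu βg (gw ∘ symm) ug
          in no-banner (symm bu) b~β βw (symm uw) ug (λ { refl → proj₁ (proj₂ (proj₁ bb)) dw }) (βu ∘ symm) bw bg βg (gw ∘ symm)

      LD : Pred Vertex 0ℓ
      LD u = ∃ λ b → L b × b ~ u

      LD? : Decidable LD
      LD? u = Fin.any? λ b → L? b ×-dec adj? b u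

      -- The clique K ∪ (B ∖ L) ∪ (D ∩ LD) separates x from the rest of D.
      separated : ⊥
      -- A vertex of `D` outside `LD` would be cut off from `x`. So `LD` contains `D`, and the
      -- merging condition in `L` makes `D` a clique.
      separated = D-nonclique λ p q dp dq p≢q → case inLD dp , inLD dq of λ where
          ((b , lb , bp) , (b′ , lb′ , b′q)) → proj₁ (proj₂ lb) b′ (proj₁ lb′) p q dp dq bp b′q p≢q
        where
        X Y : Pred Vertex 0ℓ
        X v = M v ⊎ L v
        Y v = D v × ¬ LD v

        L⇒¬D : ∀ {b} → L b → ¬ D b
        L⇒¬D lb = proj₁ (proj₂ (proj₁ (proj₁ lb)))

        Z : Vertex → Set
        Z v = K v ⊎ (B v × ¬ L v) ⊎ (D v × LD v)

        inZ : ∀ {v} → A v → ¬ X v → ¬ Y v → Z v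
        inZ {v} av ¬xv ¬yv with D? v
        ... | yes dv = inj₂ (inj₂ (dv , decidable-stable (LD? v) λ ¬ld → ¬yv (dv , ¬ld)))
        ... | no ¬dv with touches? v
        ...   | no ¬tv = contradiction (inj₁ (av , ¬dv , ¬tv)) ¬xv
        ...   | yes tv with clique? (ND? v)
        ...     | yes cl = inj₂ (inj₁ (((av , ¬dv , tv) , cl) , ¬xv ∘ inj₂))
        ...     | no ¬cl = inj₁ ((av , ¬dv , tv) , ¬cl)

        K~B∖L : ∀ {u v} → K u → B v → ¬ L v → u ~ v
        K~B∖L ku bv ¬lv = adjacent λ uv → ¬lv (not-complete-K⇒L bv ku (uv ∘ symm))

        K~LD : ∀ {u v} → K u → D v → LD v → u ~ v
        K~LD {u} {v} ku dv (b , (_ , _ , complete) , bv) = complete u v ku dv bv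

        B∖L~LD : ∀ {u v} → B u → ¬ L u → D v → LD v → u ~ v
        B∖L~LD bu ¬lu dv (b , lb , bv) = adjacent λ uv → ¬lu (L-closed lb dv bv bu uv)

        Z-clique : ∀ {u v} → Z u → Z v → u ≢ v → u ~ v
        Z-clique (inj₁ ku) (inj₁ kv) u≢v = K-clique _ _ ku kv u≢v
        Z-clique (inj₁ ku) (inj₂ (inj₁ (bv , ¬lv))) _ = K~B∖L ku bv ¬lv
        Z-clique (inj₁ ku) (inj₂ (inj₂ (dv , ldv))) _ = K~LD ku dv ldv
        Z-clique (inj₂ (inj₁ (bu , ¬lu))) (inj₁ kv) _ = symm (K~B∖L kv bu ¬lu)
        Z-clique (inj₂ (inj₁ (bu , _))) (inj₂ (inj₁ (bv , _))) u≢v = B-clique _ _ bu bv u≢v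
        Z-clique (inj₂ (inj₁ (bu , ¬lu))) (inj₂ (inj₂ (dv , ldv))) _ = B∖L~LD bu ¬lu dv ldv
        Z-clique (inj₂ (inj₂ (du , ldu))) (inj₁ kv) _ = symm (K~LD kv du ldu)
        Z-clique (inj₂ (inj₂ (du , ldu))) (inj₂ (inj₁ (bv , ¬lv))) _ = symm (B∖L~LD bv ¬lv du ldu)
        Z-clique (inj₂ (inj₂ (du , (b , lb , bu)))) (inj₂ (inj₂ (dv , (b′ , lb′ , b′v)))) u≢v =
          proj₁ (proj₂ lb) b′ (proj₁ lb′) _ _ du dv bu b′v u≢v

        inLD : ∀ {p} → D p → LD p
        inLD {p} dp = decidable-stable (LD? p) λ ¬ldp →
          no-clique-cutset critical A? (λ v → M? v ⊎-dec L? v) (λ v → D? v ×-dec ¬? (LD? v))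
            (λ where
              (inj₁ (_ , _ , ¬tu)) (dv , _) uv → ¬tu (_ , dv , uv)
              (inj₂ lu) (_ , ¬ldv) uv → ¬ldv (_ , lu , uv))
            (λ where
              (inj₁ (_ , ¬dv , _)) (dv , _) → ¬dv dv
              (inj₂ lv) (dv , _) → L⇒¬D lv dv)
            (λ au ¬xu ¬yu av ¬xv ¬yv → Z-clique (inZ au ¬xu ¬yu) (inZ av ¬xv ¬yv))
            (proj₁ Mx) (inj₁ Mx) (D⊆A dp) (dp , ¬ldp)

  Stable : Vertex → Vertex → Vertex → Set
  Stable a b c = (a ≢ b × a ≢ c × b ≢ c) × (a ≁ b × a ≁ c × b ≁ c)

  -- From an excluded path plus vertex to an excluded stable triple

  module _ {q : ℕ} {A : Pred Vertex 0ℓ} (A? : Decidable A)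
    (critical : Critical q A) (co-connected : Connected _≁_ A) where

    -- Starting from the path, `D` absorbs any `n` in `N` that has a non-neighbour `m` in `M`: `D`
    -- stays connected and `m` stays far from it. When this stops, `M` is complete to `N`.
    no-P₃+K₁ : ∀ {u v w x} → A u → A v → A w → A x →
      u ~ v → v ~ w → u ≢ w → u ≁ w → x ≁ u → x ≁ v → x ≁ w → ⊥
    no-P₃+K₁ {u} {v} {w} {x} au av aw ax uv vw u≢w uw xu xv xw =
      case grow I Done step start! start of λ where
        (ds , (ds⊆A , conn , ¬cl , _ , mx) , done) →
          Separation.separated A? (_∈? ds) critical co-connected ds⊆A conn ¬cl done mx
      where
      _∈?_ = DecMembership._∈?_ Fin._≟_
      module ∂ (ds : List Vertex) = Boundary A? (_∈? ds)

      I : List Vertex → Set₁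
      I ds = (∀ {d} → d ∈ ds → A d) × Connected _~_ (_∈ ds) × ¬ Clique (_∈ ds) × ∃ (∂.M ds)

      Done : List Vertex → Set
      Done ds = ∀ {m n} → ∂.M ds m → ∂.N ds n → m ~ n

      start! : Unique (u ∷ v ∷ w ∷ [])
      start! = ((λ { refl → irrefl refl uv }) ∷ u≢w ∷ []) ∷ ((λ { refl → irrefl refl vw }) ∷ []) ∷ [] ∷ []

      start : I (u ∷ v ∷ w ∷ [])
      start = (λ { (here refl) → au ; (there (here refl)) → av ; (there (there (here refl))) → aw })
            , ∷-connected symm (here refl) uv (∷-connected symm (here refl) vw singleton-connected)
            , (λ cl → uw (cl u w (here refl) (there (there (here refl))) u≢w))
            , x , ax
            , (λ { (here refl) → xv uv ; (there (here refl)) → xu (symm uv) ; (there (there (here refl))) → xv (symm vw) })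
            , λ { (_ , here refl , e) → xu e ; (_ , there (here refl) , e) → xv e ; (_ , there (there (here refl)) , e) → xw e }

      step : ∀ {ds} → I ds → Done ds ⊎ ∃ λ n → n ∉ ds × I (n ∷ ds)
      step {ds} (ds⊆A , conn , ¬cl , _)
        with Fin.any? (λ m → Fin.any? λ n → ∂.M? ds m ×-dec (∂.N? ds n ×-dec ¬? (adj? m n)))
      ... | no none = inj₁ λ {m} {n} mm nn → adjacent λ mn → none (m , n , mm , nn , mn)
      ... | yes (m , n , (am , m∉ , m-far) , (an , n∉ , d , d∈ , nd) , mn) = inj₂ (n , n∉ ,
          (λ { (here refl) → an ; (there e) → ds⊆A e })
        , ∷-connected symm d∈ nd conn
        , (λ cl → ¬cl λ u v u∈ v∈ → cl u v (there u∈) (there v∈))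
        , m , am
        , (λ { (here refl) → m-far (d , d∈ , nd) ; (there e) → m∉ e })
        , λ { (_ , here refl , e) → mn e ; (_ , there e∈ , e) → m-far (_ , e∈ , e) })

    stable-rotate : ∀ {a b c} → Stable a b c → Stable b c a
    stable-rotate ((ab , ac , bc) , (ab′ , ac′ , bc′)) = (bc , ab ∘ sym , ac ∘ sym) , (bc′ , ab′ ∘ symm , ac′ ∘ symm)

    All³ : Vertex → Vertex → Vertex → Set
    All³ a b c = A a × A b × A c

    two⇒three : ∀ {a b c v} → All³ a b c → A v → Stable a b c → v ~ a → v ~ b → v ~ c
    two⇒three (aa , ab , ac) av ((a≢b , _ , _) , (a≁b , a≁c , b≁c)) va vb = adjacent λ vc →
      no-P₃+K₁ aa av ab ac (symm va) vb a≢b a≁b (a≁c ∘ symm) (vc ∘ symm) (b≁c ∘ symm)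

    -- The common neighbours of the triple are closed under non-adjacency: if `y` misses a common
    -- neighbour `u`, it cannot miss two of the three, by `no-P₃+K₁`, nor just one, by `two⇒three`.
    -- Co-connectedness would then make `a` adjacent to itself.
    at-most-one-neighbour : ∀ {a b c v} → All³ a b c → A v → Stable a b c → v ~ a → v ~ b → ⊥
    at-most-one-neighbour {a} {b} {c} {v} as@(aa , ab , ac) av st@((a≢b , a≢c , b≢c) , (a≁b , a≁c , b≁c)) va vb =
      irrefl refl (proj₁ (co-connected Q step av aa (va , vb , two⇒three as av st va vb)))
      where
      Q : Pred Vertex 0ℓ
      Q v = v ~ a × v ~ b × v ~ c
      step : ∀ {u y} → A u → A y → u ≁ y → Q u → Q y
      step {u} {y} au ay u≁y (ua , ub , uc) with adj? y a | adj? y b | adj? y c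
      ... | yes ya | yes yb | yes yc = ya , yb , yc
      ... | no ya | no yb | _ = ⊥-elim (no-P₃+K₁ aa au ab ay (symm ua) ub a≢b a≁b ya (u≁y ∘ symm) yb)
      ... | no ya | yes _ | no yc = ⊥-elim (no-P₃+K₁ aa au ac ay (symm ua) uc a≢c a≁c ya (u≁y ∘ symm) yc)
      ... | yes _ | no yb | no yc = ⊥-elim (no-P₃+K₁ ab au ac ay (symm ub) uc b≢c b≁c yb (u≁y ∘ symm) yc)
      ... | yes ya | yes yb | no yc = contradiction (two⇒three as ay st ya yb) yc
      ... | no ya | yes yb | yes yc =
        contradiction (two⇒three (ab , ac , aa) ay (stable-rotate st) yb yc) ya
      ... | yes ya | no yb | yes yc =
        contradiction (two⇒three (ac , aa , ab) ay (stable-rotate (stable-rotate st)) yc ya) yb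

    -- If `u` completes `b`, `c` to a stable triple, a neighbour of `u` sees neither `b` nor `c`, so
    -- it completes them as well. Connectedness carries this from `a` to `b`, which is absurd.
    no-stable-triple : ∀ {a b c} → All³ a b c → Stable a b c → ⊥
    no-stable-triple {a} {b} {c} (aa , ab , ac) ((a≢b , a≢c , b≢c) , (a≁b , a≁c , b≁c)) =
      proj₁ (critical⇒connected critical A? Q Q? step aa ab (a≢b , a≢c , a≁b , a≁c)) refl
      where
      Q : Pred Vertex 0ℓ
      Q v = v ≢ b × v ≢ c × v ≁ b × v ≁ c
      Q? : Decidable Q
      Q? v = ¬? (v Fin.≟ b) ×-dec (¬? (v Fin.≟ c) ×-dec (¬? (adj? v b) ×-dec ¬? (adj? v c)))
      step : ∀ {u v} → A u → A v → u ~ v → Q u → Q v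
      step au av uv (u≢b , u≢c , u≁b , u≁c) =
          (λ { refl → u≁b uv }) , (λ { refl → u≁c uv })
        , at-most-one-neighbour (au , ab , ac) av st (symm uv)
        , at-most-one-neighbour (au , ac , ab) av ((u≢c , u≢b , b≢c ∘ sym) , (u≁c , u≁b , b≁c ∘ symm)) (symm uv)
        where st = (u≢b , u≢c , b≢c) , (u≁b , u≁c , b≁c)

  critical⇒no-stable-triple : ∀ {p W} → Critical p W → Decidable W →
    ∀ {a b c} → W a → W b → W c → Stable a b c → ⊥
  critical⇒no-stable-triple {p} {W} critical W? {a} {b} {c} wa wb wc st@(_ , (a≁b , a≁c , _)) =
    case grow I Done step ([] ∷ []) start of λ where
      (as , (as⊆W , conn , a∈) , complete) →
        let a≁ = λ {v} wv a≁v → decidable-stable (v ∈? as) λ v∉ → a≁v (complete a∈ wv v∉) in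
        no-stable-triple (_∈? as)
          (proj₂ (critical-component critical W? (_∈? as) as⊆W complete a∈))
          conn (a∈ , a≁ wb a≁b , a≁ wc a≁c) st
    where
    _∈?_ = DecMembership._∈?_ Fin._≟_
    I : List Vertex → Set₁
    I as = (∀ {v} → v ∈ as → W v) × Connected _≁_ (_∈ as) × a ∈ as
    Done : List Vertex → Set
    Done as = ∀ {u v} → u ∈ as → W v → v ∉ as → u ~ v
    start : I [ a ]
    start = (λ { (here refl) → wa }) , singleton-connected , here refl
    step : ∀ {as} → I as → Done as ⊎ ∃ λ v → v ∉ as × I (v ∷ as)
    step {as} (as⊆W , conn , a∈)
      with Fin.any? (λ u → Fin.any? λ v → (u ∈? as) ×-dec (W? v ×-dec (¬? (v ∈? as) ×-dec ¬? (adj? u v))))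
    ... | no none = inj₁ λ {u} {v} u∈ wv v∉ → adjacent λ uv → none (u , v , u∈ , wv , v∉ , uv)
    ... | yes (u , v , u∈ , wv , v∉ , uv) = inj₂ (v , v∉ ,
      (λ { (here refl) → wv ; (there e) → as⊆W e }) ,
      ∷-connected (λ r → r ∘ symm) u∈ (uv ∘ symm) conn , there a∈)

-- Matchings of the complement

module _ {A B : Set} where

  infixr 5 _⊕_
  -- A tagged union, by which an inequality between sums of lengths follows from a single injection.
  _⊕_ : List A → List B → List (A ⊎ B)
  xs ⊕ ys = map inj₁ xs ++ map inj₂ ys

  length-⊕ : ∀ xs ys → length (xs ⊕ ys) ≡ length xs + length ys
  length-⊕ xs ys = trans (length-++ (map inj₁ xs)) (cong₂ _+_ (length-map inj₁ xs) (length-map inj₂ ys))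

  inj₁∈⊕ : ∀ {xs ys x} → x ∈ xs → inj₁ x ∈ xs ⊕ ys
  inj₁∈⊕ x∈ = ∈-++⁺ˡ (∈-map⁺ inj₁ x∈)

  inj₂∈⊕ : ∀ xs {ys y} → y ∈ ys → inj₂ y ∈ xs ⊕ ys
  inj₂∈⊕ xs y∈ = ∈-++⁺ʳ (map inj₁ xs) (∈-map⁺ inj₂ y∈)

  ∈⊕⇒inj₁ : ∀ xs {ys x} → inj₁ x ∈ xs ⊕ ys → x ∈ xs
  ∈⊕⇒inj₁ xs x∈ with ∈-++⁻ (map inj₁ xs) x∈
  ... | inj₁ e with ∈-map⁻ inj₁ e
  ...   | _ , x∈ , refl = x∈
  ∈⊕⇒inj₁ xs x∈ | inj₂ e with ∈-map⁻ inj₂ e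
  ...   | _ , _ , ()

  ∈⊕⇒inj₂ : ∀ xs {ys y} → inj₂ y ∈ xs ⊕ ys → y ∈ ys
  ∈⊕⇒inj₂ xs y∈ with ∈-++⁻ (map inj₁ xs) y∈
  ... | inj₂ e with ∈-map⁻ inj₂ e
  ...   | _ , y∈ , refl = y∈
  ∈⊕⇒inj₂ xs y∈ | inj₁ e with ∈-map⁻ inj₁ e
  ...   | _ , _ , ()

  ⊕-unique : ∀ {xs ys} → Unique xs → Unique ys → Unique (xs ⊕ ys)
  ⊕-unique xs! ys! = ++⁺ (map⁺ inj₁-injective xs!) (map⁺ inj₂-injective ys!) λ (x∈ , y∈) →
    case ∈-map⁻ inj₁ x∈ of λ where
      (_ , _ , refl) → case ∈-map⁻ inj₂ y∈ of λ where (_ , _ , ())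

length≤∣∣ : ∀ {n} {xs : List (Fin n)} {S : Subset n} → Unique xs → (∀ {x} → x ∈ xs → x Subset.∈ S) →
            length xs ≤ ∣ S ∣
length≤∣∣ {xs = []} _ _ = z≤n
length≤∣∣ {xs = x ∷ xs} (x≢ ∷ xs!) xs⊆S = ≤-<-trans
  (length≤∣∣ xs! λ y∈ → x∈p∧x≢y⇒x∈p-y (xs⊆S (there y∈)) (All.lookup x≢ y∈ ∘ sym))
  (x∈p⇒∣p-x∣<∣p∣ (xs⊆S (here refl)))

module _ {n} {P : Pred (Fin n) 0ℓ} (P? : Decidable P) where

  ∈-tabulate⁺′ : ∀ {x} → P x → x Subset.∈ tabulate (does ∘ P?)
  ∈-tabulate⁺′ {x} px = lookup⇒[]= x _ (trans (lookup∘tabulate (does ∘ P?) x) (dec-true (P? x) px))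

  ∈-tabulate⁻′ : ∀ {x} → x Subset.∈ tabulate (does ∘ P?) → P x
  ∈-tabulate⁻′ {x} x∈ = decidable-stable (P? x) λ ¬px → contradiction
    (trans (sym (trans (lookup∘tabulate (does ∘ P?) x) (dec-false (P? x) ¬px))) ([]=⇒lookup x∈)) λ ()

module Matching (G : Graph) where
  open Colouring G
  open Swap (Fin._≟_ {order})

  module _ {p : ℕ} {W : Pred Vertex 0ℓ} (W? : Decidable W) (critical : Critical p W)
    (no-stable : ∀ {a b c} → W a → W b → W c → a ≢ b → a ≢ c → b ≢ c → a ≁ b → a ≁ c → b ≁ c → ⊥) where

    ws : List Vertex
    ws = filter W? (allFin order)

    ws! : Unique ws
    ws! = filter⁺ W? (allFin⁺ order)

    ∈ws : ∀ {v} → W v → v ∈ ws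
    ∈ws wv = ∈-filter⁺ W? (∈-allFin _) wv

    ws⊆W : ∀ {v} → v ∈ ws → W v
    ws⊆W v∈ = proj₂ (∈-filter⁻ W? {xs = allFin order} v∈)

    -- A matching of the complement, as an involution whose fixed points are the
    -- unmatched vertices.
    record CoMatching (m : Vertex → Vertex) : Set where
      field
        closed : ∀ {v} → W v → W (m v)
        involutive : ∀ {v} → W v → m (m v) ≡ v
        matched≁ : ∀ {v} → W v → v ≁ m v

      injective : ∀ {u v} → W u → W v → m u ≡ m v → u ≡ v
      injective wu wv eq = trans (sym (involutive wu)) (trans (cong m eq) (involutive wv))

    open CoMatching

    subset : ∀ {P : Pred Vertex 0ℓ} → Decidable P → List Vertex
    subset P? = filter P? ws

    module _ {P : Pred Vertex 0ℓ} (P? : Decidable P) where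
      ∈subset⁺ : ∀ {v} → W v → P v → v ∈ subset P?
      ∈subset⁺ wv pv = ∈-filter⁺ P? (∈ws wv) pv

      ∈subset⁻ : ∀ {v} → v ∈ subset P? → W v × P v
      ∈subset⁻ v∈ = case ∈-filter⁻ P? {xs = ws} v∈ of λ where (v∈ws , pv) → ws⊆W v∈ws , pv

      subset! : Unique (subset P?)
      subset! = filter⁺ P? ws!

    Fixed? : ∀ (m : Vertex → Vertex) → Decidable (λ v → m v ≡ v)
    Fixed? m v = m v Fin.≟ v

    n : ℕ
    n = length ws

    fixed : (Vertex → Vertex) → List Vertex
    fixed m = subset (Fixed? m)

    module _ {m : Vertex → Vertex} (μ : CoMatching m) where

      -- One vertex per orbit of `m`: every fixed point and the smaller end of every pair.
      reps : List Vertex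
      reps = subset (λ v → v Fin.≤? m v)

      -- The first copy of a representative goes to itself, the second to its partner or, if it has
      -- none, to its place among the fixed points.
      2reps≤ : length reps + length reps ≤ n + length (fixed m)
      2reps≤ = subst₂ _≤_ (length-⊕ reps reps) (length-⊕ ws (fixed m))
        (length-≤ f (⊕-unique (subset! _) (subset! _)) into inj)
        where
        f : Vertex ⊎ Vertex → Vertex ⊎ Vertex
        f (inj₁ v) = inj₁ v
        f (inj₂ v) with m v Fin.≟ v
        ... | yes _ = inj₂ v
        ... | no _  = inj₁ (m v)
        ∈reps : ∀ {v} → v ∈ reps → W v × v ≤ᶠ m v
        ∈reps = ∈subset⁻ (λ v → v Fin.≤? m v)
        into : ∀ {x} → x ∈ reps ⊕ reps → f x ∈ ws ⊕ fixed m
        into {inj₁ v} v∈ = inj₁∈⊕ (∈ws (proj₁ (∈reps (∈⊕⇒inj₁ reps v∈))))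
        into {inj₂ v} v∈ with wv ← proj₁ (∈reps (∈⊕⇒inj₂ reps v∈)) | m v Fin.≟ v
        ... | yes mv = inj₂∈⊕ ws (∈subset⁺ (Fixed? m) wv mv)
        ... | no _   = inj₁∈⊕ (∈ws (closed μ wv))
        clash : ∀ {u v} → u ∈ reps → v ∈ reps → m v ≢ v → u ≢ m v
        clash u∈ v∈ mv≢v refl with ∈reps u∈ | ∈reps v∈
        ... | _ , mv≤ | wv , v≤ = mv≢v (Fin.≤-antisym (subst (m _ ≤ᶠ_) (involutive μ wv) mv≤) v≤)
        inj : ∀ {x y} → x ∈ reps ⊕ reps → y ∈ reps ⊕ reps → f x ≡ f y → x ≡ y
        inj {inj₁ u} {inj₁ v} _ _ eq = eq
        inj {inj₁ u} {inj₂ v} u∈ v∈ eq with m v Fin.≟ v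
        ... | no mv≢v = contradiction (inj₁-injective eq) (clash (∈⊕⇒inj₁ reps u∈) (∈⊕⇒inj₂ reps v∈) mv≢v)
        inj {inj₁ u} {inj₂ v} u∈ v∈ () | yes _
        inj {inj₂ u} {inj₁ v} u∈ v∈ eq with m u Fin.≟ u
        ... | no mu≢u = contradiction (sym (inj₁-injective eq)) (clash (∈⊕⇒inj₁ reps v∈) (∈⊕⇒inj₂ reps u∈) mu≢u)
        inj {inj₂ u} {inj₁ v} u∈ v∈ () | yes _
        inj {inj₂ u} {inj₂ v} u∈ v∈ eq with m u Fin.≟ u | m v Fin.≟ v
        ... | yes _ | yes _ = eq
        ... | no _ | no _ = cong inj₂ (injective μ (proj₁ (∈reps (∈⊕⇒inj₂ reps u∈)))
                              (proj₁ (∈reps (∈⊕⇒inj₂ reps v∈))) (inj₁-injective eq))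
        inj {inj₂ u} {inj₂ v} u∈ v∈ () | yes _ | no _
        inj {inj₂ u} {inj₂ v} u∈ v∈ () | no _ | yes _

      orbit-colouring : length reps ≤ p → Col p W
      orbit-colouring ≤p = c , c< , proper
        where
        rep : ∀ {v} → W v → ∃ λ r → r ∈ reps × (r ≡ v ⊎ r ≡ m v)
        rep {v} wv with v Fin.≤? m v
        ... | yes v≤ = v , ∈subset⁺ (λ v → v Fin.≤? m v) wv v≤ , inj₁ refl
        ... | no v≰ = m v , ∈subset⁺ (λ v → v Fin.≤? m v) (closed μ wv)
              (subst (m v ≤ᶠ_) (sym (involutive μ wv)) (<⇒≤ (≰⇒> v≰))) , inj₂ refl
        c : Vertex → ℕ
        c v with W? v
        ... | yes wv = toℕ (index (proj₁ (proj₂ (rep wv))))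
        ... | no _   = 0
        c< : ∀ v → W v → c v < p
        c< v wv with W? v
        ... | yes wv′ = <-≤-trans (Fin.toℕ<n (index (proj₁ (proj₂ (rep wv′))))) ≤p
        ... | no ¬wv  = contradiction wv ¬wv
        proper : ∀ u v → W u → W v → u ~ v → c u ≢ c v
        proper u v wu wv uv with W? u | W? v
        ... | no ¬wu | _ = contradiction wu ¬wu
        ... | yes _ | no ¬wv = contradiction wv ¬wv
        ... | yes wu′ | yes wv′ with rep wu′ | rep wv′
        ...   | r , r∈ , ru | s , s∈ , sv = λ eq →
          absurd ru sv (index-injective (setoid Vertex) r∈ s∈ (Fin.toℕ-injective eq))
          where
          absurd : ∀ {r s} → r ≡ u ⊎ r ≡ m u → s ≡ v ⊎ s ≡ m v → r ≡ s → ⊥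
          absurd (inj₁ refl) (inj₁ refl) eq = irrefl eq uv
          absurd (inj₁ refl) (inj₂ refl) refl = matched≁ μ wv (symm uv)
          absurd (inj₂ refl) (inj₁ refl) refl = matched≁ μ wu uv
          absurd (inj₂ refl) (inj₂ refl) eq = irrefl (injective μ wu wv eq) uv

      -- The orbits are stable sets, so they number at least `p` + 1, `W` not being `p`-colourable.
      orbit-bound : suc p + suc p ≤ n + length (fixed m)
      orbit-bound = ≮⇒≥ λ few → proj₁ critical (orbit-colouring (≮⇒≥ λ p< →
        <-irrefl refl (<-≤-trans few (≤-trans (+-mono-≤ p< p<) 2reps≤))))

    -- By `orbit-bound`, `tight` says that the number of fixed points is the least possible, so the
    -- matching is maximum.
    record Maximum (m : Vertex → Vertex) : Set where
      field
        coMatching : CoMatching m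
        tight : n + length (fixed m) ≤ suc p + suc p
      open CoMatching coMatching public

      tight≡ : n + length (fixed m) ≡ suc p + suc p
      tight≡ = ≤-antisym tight (orbit-bound coMatching)

    open Maximum using (coMatching; tight)

    -- Colour `W - r` with `p` colours and give `r` the new colour `p`. Without stable triples, the
    -- classes have at most two vertices and are the orbits of a matching.
    maximum-fixing : ∀ {r} → W r → ∃ λ m → Maximum m × m r ≡ r
    maximum-fixing {r} wr with proj₂ critical wr
    ... | c₀ , c₀< , proper₀ = m , record { coMatching = μ ; tight = tight′ } , mr
      where
      c : Vertex → ℕ
      c v with v Fin.≟ r
      ... | yes _ = p
      ... | no _  = c₀ v
      c< : ∀ {v} → W v → c v < suc p
      c< {v} wv with v Fin.≟ r
      ... | yes _  = ≤-refl
      ... | no v≢r = m<n⇒m<1+n (c₀< v (wv , v≢r))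
      proper : ∀ {u v} → W u → W v → c u ≡ c v → u ≁ v
      proper {u} {v} wu wv eq uv with u Fin.≟ r | v Fin.≟ r
      ... | yes refl | yes refl = irrefl refl uv
      ... | yes _ | no v≢r = <-irrefl (sym eq) (c₀< v (wv , v≢r))
      ... | no u≢r | yes _ = <-irrefl eq (c₀< u (wu , u≢r))
      ... | no u≢r | no v≢r = proper₀ u v (wu , u≢r) (wv , v≢r) uv eq
      Partner : Vertex → Vertex → Set
      Partner v w = W w × w ≢ v × c w ≡ c v
      partner? : ∀ v → Dec (∃ (Partner v))
      partner? v = Fin.any? λ w → W? w ×-dec (¬? (w Fin.≟ v) ×-dec (c w ≟ c v))
      partner-unique : ∀ {v w w′} → W v → Partner v w → Partner v w′ → w ≡ w′
      partner-unique {v} {w} {w′} wv (ww , w≢v , cw) (ww′ , w′≢v , cw′) =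
        decidable-stable (w Fin.≟ w′) λ w≢w′ → no-stable wv ww ww′ (w≢v ∘ sym) (w′≢v ∘ sym) w≢w′
          (proper wv ww (sym cw)) (proper wv ww′ (sym cw′)) (proper ww ww′ (trans cw (sym cw′)))
      m : Vertex → Vertex
      m v with partner? v
      ... | yes (w , _) = w
      ... | no _ = v
      m-partner : ∀ {v w} → W v → Partner v w → m v ≡ w
      m-partner {v} wv π with partner? v
      ... | yes (_ , π′) = partner-unique wv π′ π
      ... | no none = contradiction (_ , π) none
      partner-m : ∀ v → Partner v (m v) ⊎ m v ≡ v
      partner-m v with partner? v
      ... | yes (_ , π) = inj₁ π
      ... | no _ = inj₂ refl
      μ : CoMatching m
      μ .closed {v} wv with partner-m v
      ... | inj₁ (ww , _) = ww
      ... | inj₂ mv≡v = subst W (sym mv≡v) wv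
      μ .involutive {v} wv with partner-m v
      ... | inj₁ (ww , w≢v , cw) = m-partner ww (wv , w≢v ∘ sym , sym cw)
      ... | inj₂ mv≡v = trans (cong m mv≡v) mv≡v
      μ .matched≁ {v} wv with partner-m v
      ... | inj₁ (ww , _ , cw) = proper wv ww (sym cw)
      ... | inj₂ mv≡v = irrefl (sym mv≡v)
      fixed-alone : ∀ {u v} → W u → W v → m v ≡ v → c u ≡ c v → u ≡ v
      fixed-alone {u} {v} wu wv mv≡v eq = decidable-stable (u Fin.≟ v) λ u≢v →
        u≢v (trans (sym (m-partner wv (wu , u≢v , eq))) mv≡v)
      cr : c r ≡ p
      cr with r Fin.≟ r
      ... | yes _ = refl
      ... | no r≢r = contradiction refl r≢r
      mr : m r ≡ r
      mr with partner-m r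
      ... | inj₂ mr≡r = mr≡r
      ... | inj₁ (ww , w≢r , cw) with m r Fin.≟ r
      ...   | yes mr≡r = mr≡r
      ...   | no _ = contradiction (trans cw cr) (<⇒≢ (c₀< (m r) (ww , w≢r)))
      -- Each colour is hit at most twice: the two ends of a pair, or the two occurrences of a fixed
      -- point, go to different copies of it.
      f : Vertex ⊎ Vertex → ℕ ⊎ ℕ
      f (inj₁ v) with v Fin.≤? m v
      ... | yes _ = inj₁ (c v)
      ... | no _  = inj₂ (c v)
      f (inj₂ v) = inj₂ (c v)
      colours = upTo (suc p)
      into : ∀ {x} → x ∈ ws ⊕ fixed m → f x ∈ colours ⊕ colours
      into {inj₁ v} v∈ with c∈ ← ∈-upTo⁺ (c< (ws⊆W (∈⊕⇒inj₁ ws v∈))) | v Fin.≤? m v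
      ... | yes _ = inj₁∈⊕ c∈
      ... | no _  = inj₂∈⊕ colours c∈
      into {inj₂ v} v∈ = inj₂∈⊕ colours (∈-upTo⁺ (c< (proj₁ (∈subset⁻ (Fixed? m) (∈⊕⇒inj₂ ws v∈)))))
      inj : ∀ {x y} → x ∈ ws ⊕ fixed m → y ∈ ws ⊕ fixed m → f x ≡ f y → x ≡ y
      inj {inj₁ u} {inj₁ v} u∈ v∈ eq
        with wu ← ws⊆W (∈⊕⇒inj₁ ws u∈) | wv ← ws⊆W (∈⊕⇒inj₁ ws v∈) | u Fin.≤? m u | v Fin.≤? m v
      ... | yes u≤ | yes v≤ = cong inj₁ (decidable-stable (u Fin.≟ v) λ u≢v → u≢v (Fin.≤-antisym
              (subst (u ≤ᶠ_) (m-partner wu (wv , u≢v ∘ sym , sym (inj₁-injective eq))) u≤)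
              (subst (v ≤ᶠ_) (m-partner wv (wu , u≢v , inj₁-injective eq)) v≤)))
      ... | no u≰ | no v≰ = cong inj₁ (decidable-stable (u Fin.≟ v) λ u≢v → <-asym
              (subst (_<ᶠ u) (m-partner wu (wv , u≢v ∘ sym , sym (inj₂-injective eq))) (≰⇒> u≰))
              (subst (_<ᶠ v) (m-partner wv (wu , u≢v , inj₂-injective eq)) (≰⇒> v≰)))
      inj {inj₁ u} {inj₁ v} u∈ v∈ () | yes _ | no _
      inj {inj₁ u} {inj₁ v} u∈ v∈ () | no _ | yes _
      inj {inj₁ u} {inj₂ v} u∈ v∈ eq with u Fin.≤? m u
      ... | no u≰ = ⊥-elim (mixed u≰ (inj₂-injective eq))
        where
        mixed : ¬ (u ≤ᶠ m u) → c u ≡ c v → ⊥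
        mixed u≰ eq with ∈subset⁻ (Fixed? m) (∈⊕⇒inj₂ ws v∈)
        ... | wv , mv≡v with fixed-alone (ws⊆W (∈⊕⇒inj₁ ws u∈)) wv mv≡v eq
        ...   | refl = u≰ (Fin.≤-reflexive (sym mv≡v))
      inj {inj₁ u} {inj₂ v} u∈ v∈ () | yes _
      inj {inj₂ u} {inj₁ v} u∈ v∈ eq = sym (inj v∈ u∈ (sym eq))
      inj {inj₂ u} {inj₂ v} u∈ v∈ eq with ∈subset⁻ (Fixed? m) (∈⊕⇒inj₂ ws u∈) | ∈subset⁻ (Fixed? m) (∈⊕⇒inj₂ ws v∈)
      ... | wu , _ | wv , mv≡v = cong inj₂ (fixed-alone wu wv mv≡v (inj₂-injective eq))
      tight′ : n + length (fixed m) ≤ suc p + suc p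
      tight′ = subst₂ _≤_ (length-⊕ ws (fixed m))
        (trans (length-⊕ colours colours) (cong₂ _+_ (length-upTo (suc p)) (length-upTo (suc p))))
        (length-≤ f (⊕-unique ws! (subset! _)) into inj)

    module _ {m : Vertex → Vertex} (M : Maximum m) where
      private module m = Maximum M

      -- Matching two non-adjacent fixed points would leave fewer fixed points.
      fixed-adjacent : ∀ {u v} → W u → W v → m u ≡ u → m v ≡ v → u ≢ v → u ~ v
      fixed-adjacent {u} {v} wu wv mu≡u mv≡v u≢v = decidable-stable (adj? u v) λ u≁v →
        <-irrefl refl (<-≤-trans (<-≤-trans (+-monoʳ-< n (<-≤-trans (n<1+n _) (n≤1+n _)))
          (≤-trans (+-monoʳ-≤ n fewer) (tight M))) (orbit-bound (paired u≁v)))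
        where
        m′ : Vertex → Vertex
        m′ w = swap u v (m w)
        m′u : m′ u ≡ v
        m′u = trans (cong (swap u v) mu≡u) (swap-left u v)
        m′v : m′ v ≡ u
        m′v = trans (cong (swap u v) mv≡v) (swap-right u v)
        m≢ : ∀ {w t} → W w → W t → m t ≡ t → w ≢ t → m w ≢ t
        m≢ ww wt mt≡t w≢t mw≡t = w≢t (m.injective ww wt (trans mw≡t (sym mt≡t)))
        m′≡m : ∀ {w} → W w → w ≢ u → w ≢ v → m′ w ≡ m w
        m′≡m ww w≢u w≢v = swap-other (m≢ ww wu mu≡u w≢u) (m≢ ww wv mv≡v w≢v)
        paired : u ≁ v → CoMatching m′
        paired u≁v .closed ww = swap-preserves W wu wv (m.closed ww)
        paired u≁v .involutive {w} ww with w Fin.≟ u | w Fin.≟ v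
        ... | yes refl | _ = trans (cong m′ m′u) m′v
        ... | no _ | yes refl = trans (cong m′ m′v) m′u
        ... | no w≢u | no w≢v = trans (cong m′ (m′≡m ww w≢u w≢v))
          (trans (m′≡m (m.closed ww) (m≢ ww wu mu≡u w≢u) (m≢ ww wv mv≡v w≢v)) (m.involutive ww))
        paired u≁v .matched≁ {w} ww with w Fin.≟ u | w Fin.≟ v
        ... | yes refl | _ = subst (u ≁_) (sym m′u) u≁v
        ... | no _ | yes refl = subst (v ≁_) (sym m′v) (u≁v ∘ symm)
        ... | no w≢u | no w≢v = subst (w ≁_) (sym (m′≡m ww w≢u w≢v)) (m.matched≁ ww)
        fewer : suc (suc (length (fixed m′))) ≤ length (fixed m)
        fewer = ⊆⇒length-≤ (∷-unique u∉ (∷-unique v∉ (subset! _))) λ where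
            (here refl) → ∈subset⁺ (Fixed? m) wu mu≡u
            (there (here refl)) → ∈subset⁺ (Fixed? m) wv mv≡v
            (there (there w∈)) → old w∈
          where
          v∉ : v ∉ fixed m′
          v∉ v∈ = u≢v (trans (sym m′v) (proj₂ (∈subset⁻ (Fixed? m′) v∈)))
          u∉ : u ∉ v ∷ fixed m′
          u∉ (here u≡v) = u≢v u≡v
          u∉ (there u∈) = u≢v (trans (sym (proj₂ (∈subset⁻ (Fixed? m′) u∈))) m′u)
          old : ∀ {w} → w ∈ fixed m′ → w ∈ fixed m
          old {w} w∈ with ∈subset⁻ (Fixed? m′) w∈
          ... | ww , m′w≡w = ∈subset⁺ (Fixed? m) ww (trans (sym (m′≡m ww
                  (λ { refl → u∉ (there w∈) }) (λ { refl → v∉ w∈ }))) m′w≡w)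

    -- The exchange step of Gallai's lemma: m leaves x and s unmatched, and m′ leaves
    -- r unmatched.  A vertex y matched by m but not by m′ is rematched in m′ as in m.
    module Exchange {m : Vertex → Vertex} (M : Maximum m) {x s r : Vertex}
      (wx : W x) (ws′ : W s) (wr : W r) (mx : m x ≡ x) (ms : m s ≡ s) (x≢s : x ≢ s)
      (r≢x : r ≢ x) (r≁x : r ≁ x) (r≢s : r ≢ s) (r≁s : r ≁ s) where

      private module m = Maximum M

      Agree? : (m′ : Vertex → Vertex) → Decidable {A = Vertex} (λ v → m′ v ≡ m v)
      Agree? m′ v = m′ v Fin.≟ m v

      agreement : (Vertex → Vertex) → List Vertex
      agreement m′ = subset (Agree? m′)

      module _ {m′ : Vertex → Vertex} (M′ : Maximum m′) (m′r : m′ r ≡ r) where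
        private module m′ = Maximum M′

        -- As `r` is fixed by `m′` and misses `x` and `s`, neither of these is fixed by `m′`. If `m`
        -- fixed all the fixed points of `m′` except perhaps `r`, it would have more fixed points
        -- than `m′`, but both have equally many.
        candidate : ∃ λ y → W y × m′ y ≡ y × m y ≢ y × y ≢ r
        candidate with Fin.any? (λ y → W? y ×-dec ((m′ y Fin.≟ y) ×-dec (¬? (m y Fin.≟ y) ×-dec ¬? (y Fin.≟ r))))
        ... | yes found = found
        ... | no none = contradiction (≤-trans few (≤-trans same many)) (<-irrefl refl)
          where
          others = filter (λ v → ¬? (v Fin.≟ r)) (fixed m′)
          others⁻ : ∀ {v} → v ∈ others → v ∈ fixed m′ × v ≢ r
          others⁻ = ∈-filter⁻ (λ v → ¬? (v Fin.≟ r)) {xs = fixed m′}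
          many : length (fixed m′) ≤ suc (length others)
          many = ⊆⇒length-≤ {ys = r ∷ others} (subset! _) λ {v} v∈ → case v Fin.≟ r of λ where
            (yes refl) → here refl
            (no v≢r)   → there (∈-filter⁺ (λ v → ¬? (v Fin.≟ r)) v∈ v≢r)
          same : length (fixed m) ≤ length (fixed m′)
          same = ≤-reflexive (+-cancelˡ-≡ n _ _ (trans m.tight≡ (sym m′.tight≡)))
          ∉others : ∀ {t} → W t → r ≢ t → r ≁ t → t ∉ others
          ∉others wt r≢t r≁t t∈ = r≁t (fixed-adjacent M′ wr wt m′r
            (proj₂ (∈subset⁻ (Fixed? m′) (proj₁ (others⁻ t∈)))) r≢t)
          few : suc (suc (length others)) ≤ length (fixed m)
          few = ⊆⇒length-≤
            (∷-unique (λ { (here x≡s) → x≢s x≡s ; (there x∈) → ∉others wx r≢x r≁x x∈ })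
              (∷-unique (∉others ws′ r≢s r≁s) (filter⁺ _ (subset! _)))) λ where
              (here refl) → ∈subset⁺ (Fixed? m) wx mx
              (there (here refl)) → ∈subset⁺ (Fixed? m) ws′ ms
              (there (there v∈)) → case others⁻ v∈ of λ where
                (v∈f , v≢r) → case ∈subset⁻ (Fixed? m′) v∈f of λ where
                  (wv , m′v) → ∈subset⁺ (Fixed? m) wv (decidable-stable (m _ Fin.≟ _) λ mv≢v → none (_ , wv , m′v , mv≢v , v≢r))

        -- Agreement with `m` grows: `y` joins it, and none of the altered vertices `y`, `z`, `w`
        -- was in it before.
        improve : ∃ λ m″ → Maximum m″ × m″ r ≡ r × suc (length (agreement m′)) ≤ length (agreement m″)
        improve with candidate
        ... | y , wy , m′y , my≢y , y≢r = m″ , record { coMatching = μ ; tight = tight″ } , m″r , more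
          where
          z = m y
          wz : W z
          wz = m.closed wy
          mz : m z ≡ y
          mz = m.involutive wy
          m′z≢z : m′ z ≢ z
          m′z≢z m′z = m.matched≁ wy (fixed-adjacent M′ wy wz m′y m′z (my≢y ∘ sym))
          w = m′ z
          ww : W w
          ww = m′.closed wz
          m′w : m′ w ≡ z
          m′w = m′.involutive wz
          w≢y : w ≢ y
          w≢y w≡y = my≢y (trans (sym m′w) (trans (cong m′ w≡y) m′y))
          -- Conjugation by this transposition replaces the pair `z`, `w` of `m′` by `y`, `z` and
          -- leaves `w` unmatched.
          σ = swap y w
          m″ : Vertex → Vertex
          m″ v = σ (m′ (σ v))
          σ-closed : ∀ {v} → W v → W (σ v)
          σ-closed = swap-preserves W wy ww
          m″y : m″ y ≡ z
          m″y = trans (cong (σ ∘ m′) (swap-left y w)) (trans (cong σ m′w) (swap-other my≢y (m′z≢z ∘ sym)))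
          m″w : m″ w ≡ w
          m″w = trans (cong (σ ∘ m′) (swap-right y w)) (trans (cong σ m′y) (swap-left y w))
          m″z : m″ z ≡ y
          m″z = trans (cong (σ ∘ m′) (swap-other my≢y (m′z≢z ∘ sym))) (swap-right y w)
          m″-other : ∀ {v} → W v → v ≢ y → v ≢ w → v ≢ z → m″ v ≡ m′ v
          m″-other wv v≢y v≢w v≢z = trans (cong (σ ∘ m′) (swap-other v≢y v≢w)) (swap-other
            (λ m′v≡y → v≢y (m′.injective wv wy (trans m′v≡y (sym m′y))))
            (λ m′v≡w → v≢z (m′.injective wv wz m′v≡w)))
          μ : CoMatching m″
          μ .closed wv = σ-closed (m′.closed (σ-closed wv))
          μ .involutive {v} wv = trans (cong (σ ∘ m′) (swap-involutive y w _))
            (trans (cong σ (m′.involutive (σ-closed wv))) (swap-involutive y w v))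
          μ .matched≁ {v} wv = case v Fin.≟ y of λ where
            (yes refl) → subst (y ≁_) (sym m″y) (m.matched≁ wy)
            (no v≢y) → case v Fin.≟ w of λ where
              (yes refl) → irrefl (sym m″w)
              (no v≢w) → case v Fin.≟ z of λ where
                (yes refl) → subst (z ≁_) (sym m″z) (m.matched≁ wy ∘ symm)
                (no v≢z) → subst (v ≁_) (sym (m″-other wv v≢y v≢w v≢z)) (m′.matched≁ wv)
          tight″ : n + length (fixed m″) ≤ suc p + suc p
          tight″ = ≤-trans (+-monoʳ-≤ n (length-≤ σ (subset! _) into λ _ _ → swap-injective y w)) m′.tight
            where
            into : ∀ {v} → v ∈ fixed m″ → σ v ∈ fixed m′
            into v∈ with ∈subset⁻ (Fixed? m″) v∈
            ... | wv , m″v = ∈subset⁺ (Fixed? m′) (σ-closed wv)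
                               (trans (sym (swap-involutive y w _)) (cong σ m″v))
          r≢w : r ≢ w
          r≢w refl = m′z≢z (trans (sym m′r) m′w)
          m″r : m″ r ≡ r
          m″r = trans (cong (σ ∘ m′) (swap-other (y≢r ∘ sym) r≢w))
            (trans (cong σ m′r) (swap-other (y≢r ∘ sym) r≢w))
          more : suc (length (agreement m′)) ≤ length (agreement m″)
          more = ⊆⇒length-≤ (∷-unique y∉ (subset! _)) λ where
              (here refl) → ∈subset⁺ (Agree? m″) wy m″y
              (there v∈) → old v∈
            where
            y∉ : y ∉ agreement m′
            y∉ y∈ = my≢y (trans (sym (proj₂ (∈subset⁻ (Agree? m′) y∈))) m′y)
            old : ∀ {v} → v ∈ agreement m′ → v ∈ agreement m″
            old {v} v∈ with ∈subset⁻ (Agree? m′) v∈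
            ... | wv , m′v = ∈subset⁺ (Agree? m″) wv (trans (m″-other wv v≢y v≢w v≢z) m′v)
              where
              v≢y : v ≢ y
              v≢y refl = y∉ v∈
              v≢z : v ≢ z
              v≢z refl = w≢y (trans m′v mz)
              v≢w : v ≢ w
              v≢w refl = w≢y (m.injective ww wy (trans (sym m′v) m′w))

      impossible : ⊥
      impossible with maximum-fixing wr
      -- Agreement never exceeds `n`, so fuel `suc n` is enough for a contradiction.
      ... | m′ , M′ , m′r = go (suc n) M′ m′r (m≤m+n (suc n) _)
        where
        go : ∀ k {m′} → Maximum m′ → m′ r ≡ r → n < k + length (agreement m′) → ⊥
        go zero M′ m′r n< = <-irrefl refl (<-≤-trans n<
          (⊆⇒length-≤ (subset! _) λ v∈ → ∈ws (proj₁ (∈subset⁻ (Agree? _) v∈))))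
        go (suc k) {m′} M′ m′r n< with improve M′ m′r
        ... | m″ , M″ , m″r , more = go k M″ m″r
          (<-≤-trans (subst (n <_) (sym (+-suc k (length (agreement m′)))) n<) (+-monoʳ-≤ k more))

    -- Two non-adjacent vertices of `R` would form a stable triple with `x`, `S` is a clique by
    -- `fixed-adjacent`, and the exchange argument joins `R` to `S`. In `count`, the two units
    -- cancelled stand for `x` in `ws` and in `fixed m`.
    degree+ω-bound : ∀ {x} → W x → p + p ≤ degree G x + ω G
    degree+ω-bound {x} wx with maximum-fixing wx
    ... | m , M , mx = ≤-trans count (+-mono-≤ nb≤ clique≤)
      where
      NonNeighbour? : Decidable {A = Vertex} (λ v → v ≢ x × v ≁ x)
      NonNeighbour? v = ¬? (v Fin.≟ x) ×-dec ¬? (adj? v x)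
      Other? : Decidable {A = Vertex} (λ v → m v ≡ v × v ≢ x)
      Other? v = (m v Fin.≟ v) ×-dec ¬? (v Fin.≟ x)
      R S nb clique : List Vertex
      R = subset NonNeighbour?
      S = subset Other?
      nb = subset (adj? x)
      clique = R ++ S

      r~s : ∀ {r s} → r ∈ R → s ∈ S → r ~ s
      r~s {r} {s} r∈ s∈ with ∈subset⁻ NonNeighbour? r∈ | ∈subset⁻ Other? s∈
      ... | wr , r≢x , r≁x | ws , ms , s≢x = decidable-stable (adj? r s) λ r≁s →
        Exchange.impossible M wx ws wr mx ms (s≢x ∘ sym) r≢x r≁x
          (λ { refl → r≁x (fixed-adjacent M wr wx ms mx r≢x) }) r≁s

      is-clique : ∀ {u v} → u ∈ clique → v ∈ clique → u ≢ v → u ~ v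
      is-clique {u} {v} u∈ v∈ u≢v with ∈-++⁻ R u∈ | ∈-++⁻ R v∈
      ... | inj₁ u∈R | inj₂ v∈S = r~s u∈R v∈S
      ... | inj₂ u∈S | inj₁ v∈R = symm (r~s v∈R u∈S)
      ... | inj₁ u∈R | inj₁ v∈R with ∈subset⁻ NonNeighbour? u∈R | ∈subset⁻ NonNeighbour? v∈R
      ...   | wu , u≢x , u≁x | wv , v≢x , v≁x = decidable-stable (adj? u v) λ u≁v →
                no-stable wu wv wx u≢v u≢x v≢x u≁v u≁x v≁x
      is-clique {u} {v} u∈ v∈ u≢v | inj₂ u∈S | inj₂ v∈S with ∈subset⁻ Other? u∈S | ∈subset⁻ Other? v∈S
      ...   | wu , mu , _ | wv , mv , _ = fixed-adjacent M wu wv mu mv u≢v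

      clique! : Unique clique
      -- A vertex common to `R` and `S` would be adjacent to itself by `r~s`.
      clique! = ++⁺ (subset! _) (subset! _) λ (v∈R , v∈S) → irrefl refl (r~s v∈R v∈S)

      nb≤ : length nb ≤ degree G x
      nb≤ = length≤∣∣ (subset! _) λ v∈ → ∈-tabulate⁺′ (adj? x) (proj₂ (∈subset⁻ (adj? x) v∈))

      clique≤ : length clique ≤ ω G
      clique≤ = ≤-trans (length≤∣∣ clique! (∈-tabulate⁺′ ∈clique?))
        (proj₂ (proj₂ (cliqueNumber G)) (tabulate (does ∘ ∈clique?) ,
          (λ u v u∈ v∈ → is-clique (∈-tabulate⁻′ ∈clique? u∈) (∈-tabulate⁻′ ∈clique? v∈)) , refl))
        where
        ∈clique? : Decidable (_∈ clique)
        ∈clique? v = DecMembership._∈?_ Fin._≟_ v clique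

      n≤ : n ≤ suc (length nb + length R)
      n≤ = subst (λ k → n ≤ suc k) (length-++ nb) (⊆⇒length-≤ {ys = x ∷ nb ++ R} ws! into)
        where
        into : ∀ {v} → v ∈ ws → v ∈ x ∷ nb ++ R
        into {v} v∈ with v Fin.≟ x | adj? x v
        ... | yes refl | _ = here refl
        ... | no _ | yes xv = there (∈-++⁺ˡ (∈subset⁺ (adj? x) (ws⊆W v∈) xv))
        ... | no v≢x | no xv = there (∈-++⁺ʳ nb (∈subset⁺ NonNeighbour? (ws⊆W v∈) (v≢x , xv ∘ symm)))

      fixed≤ : length (fixed m) ≤ suc (length S)
      fixed≤ = ⊆⇒length-≤ {ys = x ∷ S} (subset! _) λ {v} v∈ → case v Fin.≟ x of λ where
        (yes refl) → here refl
        (no v≢x) → case ∈subset⁻ (Fixed? m) v∈ of λ where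
          (wv , mv) → there (∈subset⁺ Other? wv (mv , v≢x))

      count : p + p ≤ length nb + length clique
      count = ≤-pred (≤-pred (begin
        suc (suc (p + p))                              ≡⟨ cong suc (+-suc p p) ⟨
        suc p + suc p                                  ≤⟨ orbit-bound (coMatching M) ⟩
        n + length (fixed m)                           ≤⟨ +-mono-≤ n≤ fixed≤ ⟩
        suc (length nb + length R) + suc (length S)    ≡⟨ cong suc (+-suc _ (length S)) ⟩
        suc (suc (length nb + length R + length S))    ≡⟨ cong (suc ∘ suc) (+-assoc (length nb) _ _) ⟩
        suc (suc (length nb + (length R + length S)))  ≡⟨ cong (λ k → suc (suc (length nb + k))) (length-++ R) ⟨
        suc (suc (length nb + length clique))          ∎))
        where open ≤-Reasoning

-- The bound on the chromatic number

degree≤Δ : ∀ G x → degree G x ≤ Δ G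
degree≤Δ G x = All.lookup (xs≤max 0 (map (degree G) (allFin (Graph.order G)))) (∈-map⁺ (degree G) (∈-allFin x))

mainTheorem1 : (G : Graph) → P₅ -Free G → Flagᶜ -Free G →
    χ G ≤ ⌈ Δ G + ω G + 1 /2⌉
mainTheorem1 G P₅-free banner-free with chromaticNumber G
... | zero , _ = z≤n
... | suc p , _ , minimal = bound
  where
  open Colouring G

  ¬col : ¬ Col p (λ _ → ⊤)
  ¬col (c , c< , proper) = <-irrefl refl (minimal
    ((λ v → fromℕ< (c< v tt)) , λ u v uv eq → proper u v tt tt uv
      (trans (sym (Fin.toℕ-fromℕ< (c< u tt))) (trans (cong toℕ eq) (Fin.toℕ-fromℕ< (c< v tt))))))

  bound : suc p ≤ ⌈ Δ G + ω G + 1 /2⌉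
  bound with critical-subset (λ _ → yes tt) ¬col
  ... | W , W? , critical with Fin.any? W?
  ...   | no empty = contradiction ((λ _ → 0) , (λ v wv → contradiction (v , wv) empty) ,
                       λ u _ wu → contradiction (u , wu) empty) (proj₁ critical)
  ...   | yes (x , wx) = begin
    -- Since ⌈(2`p` + 1)/2⌉ = `p` + 1, it suffices that 2`p` ≤ Δ + ω.
    suc p                       ≡⟨ cong suc (n≡⌊n+n/2⌋ p) ⟩
    ⌊ suc (suc (p + p)) /2⌋     ≡⟨⟩
    ⌈ suc (p + p) /2⌉           ≤⟨ ⌈n/2⌉-mono (s≤s (≤-trans (degree+ω-bound W? critical no-stable wx)
                                     (+-monoˡ-≤ (ω G) (degree≤Δ G x)))) ⟩
    ⌈ suc (Δ G + ω G) /2⌉       ≡⟨ cong ⌈_/2⌉ (+-comm 1 (Δ G + ω G)) ⟩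
    ⌈ Δ G + ω G + 1 /2⌉         ∎
    where
    open ≤-Reasoning
    open Matching G
    no-stable : ∀ {a b c} → W a → W b → W c → a ≢ b → a ≢ c → b ≢ c → a ≁ b → a ≁ c → b ≁ c → ⊥
    no-stable wa wb wc ab ac bc ab′ ac′ bc′ = Structure.critical⇒no-stable-triple G P₅-free banner-free
      critical W? wa wb wc ((ab , ac , bc) , (ab′ , ac′ , bc′))
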